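{- As formal power series in $x$ with coefficients in $\mathbb{Q}[s,t,u,v]$, $$P^{(\mathsf{pk},\mathsf{val},\mathsf{dasc},\mathsf{ddes})}(s,t,u,v;x)=\frac{t\,\frac{\partial}{\partial x}V\big(st,(u+v)/2;x\big)}{1-st\,V\big(st,(u+v)/2;x\big)}.$$
   Context: Let $\mathfrak{S}_n$ be the set of permutations $\pi=\pi_1\cdots\pi_n$ (one-line notation) of $[n]=\{1,\dots,n\}$. Use the convention $\pi_0=\pi_{n+1}=\infty$. A letter $\pi_i$ ($1\le i\le n$) of $\pi$ is a peak if $\pi_{i-1}<\pi_i>\pi_{i+1}$ (so necessarily $2\le i\le n-1$), a valley if $\pi_{i-1}>\pi_i<\pi_{i+1}$, a double ascent if $\pi_{i-1}<\pi_i<\pi_{i+1}$, and a double descent if $\pi_{i-1}>\pi_i>\pi_{i+1}$. Let $\mathsf{pk}(\pi),\mathsf{val}(\pi),\mathsf{dasc}(\pi),\mathsf{ddes}(\pi)$ be the numbers of peaks, valleys, double ascents and double descents of $\pi$, respectively. Define $$P^{(\mathsf{pk},\mathsf{val},\mathsf{dasc},\mathsf{ddes})}(s,t,u,v;x)=\sum_{n=1}^\infty\Big(\sum_{\pi\in\mathfrak{S}_n}s^{\mathsf{pk}(\pi)}t^{\mathsf{val}(\pi)}u^{\mathsf{dasc}(\pi)}v^{\mathsf{ddes}(\pi)}\Big)\frac{x^n}{n!}.$$ The bivariate Chebyshev polynomials of the second kind are defined by $U_0(s,t)=1$, $U_1(s,t)=2t$, and $U_n(s,t)=2tU_{n-1}(s,t)-sU_{n-2}(s,t)$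 for $n\ge2$. Define $V(s,t;x)=\sum_{n=0}^\infty U_n(s,t)\frac{x^{n+2}}{(n+2)!}$; $V(st,(u+v)/2;x)$ denotes the series obtained by substituting $st$ for the first argument $s$ and $(u+v)/2$ for the second argument $t$. -}

module Defs where

open import Algebra.Bundles using (CommutativeRing)
import Algebra.Definitions as AlgebraDefinitions
import Algebra.Properties.Ring as RingProperties
import Algebra.Properties.Semiring.Exp as Exponentiation
import Algebra.Properties.Semiring.Mult as Multiplication
import Algebra.Properties.Semiring.Sum as Summation
open import Data.Fin.Base as Fin using (Fin; zero; suc; toℕ; inject₁)
import Data.Fin.Properties as Fin
open import Data.Integer.Base using (+_)
open import Data.List.Base as List using (List; []; _∷_)
open import Data.Nat.Base as ℕ using (ℕ; zero; suc; _∸_; _≤_; z≤n; s≤s; _!)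
import Data.Nat.Properties as ℕ
open import Data.Nat.Properties using (_!≢0)
open import Data.Product.Base using (_×_; _,_; proj₁)
open import Data.Rational.Base as ℚ using (ℚ; ½)
import Data.Rational.Properties as ℚ
open import Data.Vec.Base as Vec using (Vec; []; _∷_; _∷ʳ_)
open import Data.Vec.Relation.Unary.AllPairs using (allPairs?)
open import Data.Vec.Relation.Unary.Unique.Propositional using (Unique)
open import Level using (0ℓ; _⊔_)
open import Relation.Binary.Construct.Add.Supremum.Strict using (<⁺-dec)
  renaming (_<⁺_ to AddSupremum)
import Relation.Binary.Reasoning.Setoid as SetoidReasoning
open import Relation.Nullary.Construct.Add.Supremum using (_⁺; [_])
  renaming (⊤⁺ to ∞)
open import Relation.Nullary.Decidable using (Dec; yes; no; ¬?; _×-dec_)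
open import Relation.Unary using (Decidable)

------------------------------------------------------------------------
-- Formal power series over a commutative ring

module PowerSeries {c ℓ} (R : CommutativeRing c ℓ) where

  open CommutativeRing R
  open Summation semiring
  private
    module ≈-Reasoning = SetoidReasoning setoid

  Series : Set c
  Series = ℕ → Carrier

  infix  4 _≈ˢ_
  infix  8 -ˢ_
  infixl 6 _+ˢ_ _-ˢ_
  infixl 7 _*ˢ_

  _≈ˢ_ : Series → Series → Set ℓ
  f ≈ˢ g = ∀ n → f n ≈ g n

  0ˢ 1ˢ : Series
  0ˢ _       = 0#
  1ˢ zero    = 1#
  1ˢ (suc _) = 0#

  _+ˢ_ _*ˢ_ : Series → Series → Series
  (f +ˢ g) n = f n + g n
  (f *ˢ g) n = sum {suc n} λ i → f (toℕ i) * g (n ∸ toℕ i)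

  -ˢ_ : Series → Series
  (-ˢ f) n = - f n

  _-ˢ_ : Series → Series → Series
  f -ˢ g = f +ˢ (-ˢ g)

  private
    shift : Series → Series
    shift f n = f (suc n)

    *ˢ-cong≤ : ∀ {f f′ g g′} n → f ≈ˢ f′ → (∀ m → m ≤ n → g m ≈ g′ m) →
               (f *ˢ g) n ≈ (f′ *ˢ g′) n
    *ˢ-cong≤ n p q = sum-cong-≋ {suc n} λ i →
      *-cong (p (toℕ i)) (q (n ∸ toℕ i) (ℕ.m∸n≤m n (toℕ i)))

    *ˢ-cong : ∀ {f f′ g g′} → f ≈ˢ f′ → g ≈ˢ g′ → f *ˢ g ≈ˢ f′ *ˢ g′
    *ˢ-cong p q n = *ˢ-cong≤ n p (λ m _ → q m)

    last-term : ∀ f g n →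
                (f *ˢ g) (suc n) ≈ (f *ˢ shift g) n + f (suc n) * g 0
    last-term f g zero = let open ≈-Reasoning in begin
      f 0 * g 1 + (f 1 * g 0 + 0#)  ≈⟨ +-congˡ (+-identityʳ _) ⟩
      f 0 * g 1 + f 1 * g 0         ≈⟨ +-congʳ (+-identityʳ _) ⟨
      (f 0 * g 1 + 0#) + f 1 * g 0  ∎
    last-term f g (suc n) =
      trans (+-congˡ (last-term (shift f) g n)) (sym (+-assoc _ _ _))

    *ˢ-comm : ∀ f g → f *ˢ g ≈ˢ g *ˢ f
    *ˢ-comm f g zero    = +-congʳ (*-comm _ _)
    *ˢ-comm f g (suc n) = let open ≈-Reasoning in begin
      f 0 * g (suc n) + (shift f *ˢ g) n  ≈⟨ +-cong (*-comm _ _) (*ˢ-comm (shift f) g n) ⟩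
      g (suc n) * f 0 + (g *ˢ shift f) n  ≈⟨ +-comm _ _ ⟩
      (g *ˢ shift f) n + g (suc n) * f 0  ≈⟨ last-term g f n ⟨
      (g *ˢ f) (suc n)                    ∎

    *ˢ-distribʳ : ∀ h f g → (f +ˢ g) *ˢ h ≈ˢ f *ˢ h +ˢ g *ˢ h
    *ˢ-distribʳ h f g n = trans
      (sum-cong-≋ {suc n} λ i → distribʳ (h (n ∸ toℕ i)) (f (toℕ i)) (g (toℕ i)))
      (∑-distrib-+ {suc n} (λ i → f (toℕ i) * h (n ∸ toℕ i)) (λ i → g (toℕ i) * h (n ∸ toℕ i)))

    *ˢ-distribˡ : ∀ h f g → h *ˢ (f +ˢ g) ≈ˢ h *ˢ f +ˢ h *ˢ g
    *ˢ-distribˡ h f g n = let open ≈-Reasoning in begin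
      (h *ˢ (f +ˢ g)) n         ≈⟨ *ˢ-comm h (f +ˢ g) n ⟩
      ((f +ˢ g) *ˢ h) n         ≈⟨ *ˢ-distribʳ h f g n ⟩
      (f *ˢ h) n + (g *ˢ h) n   ≈⟨ +-cong (*ˢ-comm f h n) (*ˢ-comm g h n) ⟩
      (h *ˢ f) n + (h *ˢ g) n   ∎

    scale-* : ∀ a f g n → ((λ k → a * f k) *ˢ g) n ≈ a * (f *ˢ g) n
    scale-* a f g n = trans
      (sum-cong-≋ {suc n} λ i → *-assoc a (f (toℕ i)) (g (n ∸ toℕ i)))
      (sym (*-distribˡ-sum {suc n} a (λ i → f (toℕ i) * g (n ∸ toℕ i))))

    *ˢ-assoc : ∀ f g h → (f *ˢ g) *ˢ h ≈ˢ f *ˢ (g *ˢ h)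
    *ˢ-assoc f g h zero = +-congʳ (let open ≈-Reasoning in begin
      (f 0 * g 0 + 0#) * h 0  ≈⟨ *-congʳ (+-identityʳ _) ⟩
      f 0 * g 0 * h 0         ≈⟨ *-assoc _ _ _ ⟩
      f 0 * (g 0 * h 0)       ≈⟨ *-congˡ (+-identityʳ _) ⟨
      f 0 * (g 0 * h 0 + 0#)  ∎)
    *ˢ-assoc f g h (suc n) = let open ≈-Reasoning in begin
      (f 0 * g 0 + 0#) * h (suc n) + (((λ k → f 0 * g (suc k)) +ˢ shift f *ˢ g) *ˢ h) n
        ≈⟨ +-cong (trans (*-congʳ (+-identityʳ _)) (*-assoc _ _ _))
                  (*ˢ-distribʳ h (λ k → f 0 * g (suc k)) (shift f *ˢ g) n) ⟩
      f 0 * (g 0 * h (suc n)) + (((λ k → f 0 * g (suc k)) *ˢ h) n + ((shift f *ˢ g) *ˢ h) n)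
        ≈⟨ +-congˡ (+-cong (scale-* (f 0) (shift g) h n) (*ˢ-assoc (shift f) g h n)) ⟩
      f 0 * (g 0 * h (suc n)) + (f 0 * (shift g *ˢ h) n + (shift f *ˢ (g *ˢ h)) n)
        ≈⟨ +-assoc _ _ _ ⟨
      f 0 * (g 0 * h (suc n)) + f 0 * (shift g *ˢ h) n + (shift f *ˢ (g *ˢ h)) n
        ≈⟨ +-congʳ (distribˡ _ _ _) ⟨
      (f *ˢ (g *ˢ h)) (suc n) ∎

    sum-zero : ∀ {n} (x : Fin n → Carrier) → (∀ i → x i ≈ 0#) → sum x ≈ 0#
    sum-zero {n} x p = trans (sum-cong-≋ {n} p) (sum-replicate-zero n)

    *ˢ-identityˡ : ∀ f → 1ˢ *ˢ f ≈ˢ f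
    *ˢ-identityˡ f zero    = trans (+-identityʳ _) (*-identityˡ _)
    *ˢ-identityˡ f (suc n) = let open ≈-Reasoning in begin
      1# * f (suc n) + (0ˢ *ˢ f) n  ≈⟨ +-cong (*-identityˡ _) (sum-zero {suc n} _ λ i → zeroˡ (f (n ∸ toℕ i))) ⟩
      f (suc n) + 0#                ≈⟨ +-identityʳ _ ⟩
      f (suc n)                     ∎

  *ˢ-vanishes : ∀ f g d e → (∀ n → d ≤ n → f n ≈ 0#) → (∀ n → e ≤ n → g n ≈ 0#) →
                ∀ n → d ℕ.+ e ≤ n → (f *ˢ g) n ≈ 0#
  *ˢ-vanishes f g d e p q n d+e≤n = sum-zero {suc n} _ λ i → term (toℕ i)
    where
    term : ∀ i → f i * g (n ∸ i) ≈ 0#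
    term i with d ℕ.≤? i
    ... | yes d≤i = trans (*-congʳ (p i d≤i)) (zeroˡ _)
    ... | no  d≰i = trans (*-congˡ (q (n ∸ i) (ℕ.m+n≤o⇒m≤o∸n e e+i≤n))) (zeroʳ _)
      where
      e+i≤n : e ℕ.+ i ≤ n
      e+i≤n = ℕ.≤-trans (ℕ.≤-reflexive (ℕ.+-comm e i))
                (ℕ.≤-trans (ℕ.+-monoˡ-≤ e (ℕ.<⇒≤ (ℕ.≰⇒> d≰i))) d+e≤n)

  powerSeriesRing : CommutativeRing c ℓ
  powerSeriesRing = record
    { Carrier = Series
    ; _≈_     = _≈ˢ_
    ; _+_     = _+ˢ_
    ; _*_     = _*ˢ_
    ; -_      = -ˢ_
    ; 0#      = 0ˢ
    ; 1#      = 1ˢ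
    ; isCommutativeRing = record
      { isRing = record
        { +-isAbelianGroup = record
          { isGroup = record
            { isMonoid = record
              { isSemigroup = record
                { isMagma = record
                  { isEquivalence = record
                    { refl  = λ n → refl
                    ; sym   = λ p n → sym (p n)
                    ; trans = λ p q n → trans (p n) (q n)
                    }
                  ; ∙-cong = λ p q n → +-cong (p n) (q n)
                  }
                ; assoc = λ f g h n → +-assoc (f n) (g n) (h n)
                }
              ; identity = (λ f n → +-identityˡ (f n)) , (λ f n → +-identityʳ (f n))
              }
            ; inverse = (λ f n → -‿inverseˡ (f n)) , (λ f n → -‿inverseʳ (f n))
            ; ⁻¹-cong = λ p n → -‿cong (p n)
            }
          ; comm = λ f g n → +-comm (f n) (g n)
          }
        ; *-cong     = *ˢ-cong
        ; *-assoc    = *ˢ-assoc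
        ; *-identity = *ˢ-identityˡ
                     , λ f n → trans (*ˢ-comm f 1ˢ n) (*ˢ-identityˡ f n)
        ; distrib    = *ˢ-distribˡ , *ˢ-distribʳ
        }
      ; *-comm = *ˢ-comm
      }
    }

  infixr 8 _·_

  _·_ : Carrier → Series → Series
  (a · f) n = a * f n

  -- Formal derivative with respect to the variable of the series.
  ∂ : Series → Series
  ∂ f n = suc n ⋆ f (suc n)
    where open Multiplication semiring using () renaming (_×_ to _⋆_)

  open AlgebraDefinitions _≈ˢ_ using (Invertible)

  IsUnit : Series → Set (c ⊔ ℓ)
  IsUnit = Invertible 1ˢ _*ˢ_

  infix 7 _/_⟨_⟩

  _/_⟨_⟩ : Series → (g : Series) → IsUnit g → Series
  f / g ⟨ unit ⟩ = f *ˢ proj₁ unit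

  -- A series with constant term 1 is a unit: its inverse is Σₖ (1 - g)ᵏ.
  module _ (g : Series) where

    private
      f : Series
      f = 1ˢ -ˢ g

    -- Σ_{j ≤ k} (1 - g)ʲ
    partialSum : ℕ → Series
    partialSum zero    = 1ˢ
    partialSum (suc k) = 1ˢ +ˢ f *ˢ partialSum k

    -- Later partial sums have the same coefficient of xⁿ.
    inverse : Series
    inverse n = partialSum n n

    module _ (g₀≈1 : g 0 ≈ 1#) where

      private
        module S = CommutativeRing powerSeriesRing

        f₀≈0 : f 0 ≈ 0#
        f₀≈0 = trans (+-congˡ (-‿cong g₀≈1)) (-‿inverseʳ 1#)

        f*-zero : ∀ h → (f *ˢ h) 0 ≈ 0#
        f*-zero h = trans (+-identityʳ _) (trans (*-congʳ f₀≈0) (zeroˡ _))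

        f*-suc : ∀ h n → (f *ˢ h) (suc n) ≈ (shift f *ˢ h) n
        f*-suc h n = trans (+-congʳ (trans (*-congʳ f₀≈0) (zeroˡ _))) (+-identityˡ _)

        f*-local : ∀ h h′ n → (∀ m → m ≤ n → h m ≈ h′ m) →
                   (f *ˢ h) (suc n) ≈ (f *ˢ h′) (suc n)
        f*-local h h′ n p = let open ≈-Reasoning in begin
          (f *ˢ h) (suc n)    ≈⟨ f*-suc h n ⟩
          (shift f *ˢ h) n    ≈⟨ *ˢ-cong≤ {shift f} {shift f} {h} {h′} n (λ _ → refl) p ⟩
          (shift f *ˢ h′) n   ≈⟨ f*-suc h′ n ⟨
          (f *ˢ h′) (suc n)   ∎

        stable-step : ∀ k m → m ≤ k → partialSum (suc k) m ≈ partialSum k m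
        stable-step zero zero z≤n = trans (+-congˡ (f*-zero 1ˢ)) (+-identityʳ _)
        stable-step (suc k) zero z≤n =
          +-congˡ (trans (f*-zero (partialSum (suc k))) (sym (f*-zero (partialSum k))))
        stable-step (suc k) (suc m) (s≤s m≤k) =
          +-congˡ (f*-local _ _ m λ i i≤m → stable-step k i (ℕ.≤-trans i≤m m≤k))

        stable′ : ∀ m d → partialSum (d ℕ.+ m) m ≈ inverse m
        stable′ m zero    = refl
        stable′ m (suc d) = trans (stable-step (d ℕ.+ m) m (ℕ.m≤n+m m d)) (stable′ m d)

        stable : ∀ k m → m ≤ k → partialSum k m ≈ inverse m
        stable k m m≤k = trans
          (reflexive (cong (λ j → partialSum j m) (sym′ (ℕ.m∸n+n≡m m≤k))))
          (stable′ m (k ∸ m))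
          where
          open import Relation.Binary.PropositionalEquality using (cong) renaming (sym to sym′)

        fixed-point : inverse ≈ˢ 1ˢ +ˢ f *ˢ inverse
        fixed-point zero    = trans (sym (+-identityʳ _)) (+-congˡ (sym (f*-zero inverse)))
        fixed-point (suc n) = +-congˡ (f*-local _ _ n (stable n))

        1-f≈g : 1ˢ -ˢ f ≈ˢ g
        1-f≈g n = let open ≈-Reasoning in begin
          1ˢ n + - (1ˢ n + - g n)        ≈⟨ +-congˡ (sym (-‿+-comm _ _)) ⟩
          1ˢ n + (- 1ˢ n + - - g n)      ≈⟨ +-assoc _ _ _ ⟨
          (1ˢ n + - 1ˢ n) + - - g n      ≈⟨ +-cong (-‿inverseʳ _) (-‿involutive _) ⟩
          0# + g n                       ≈⟨ +-identityˡ _ ⟩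
          g n                            ∎
          where
          open RingProperties ring using (-‿+-comm; -‿involutive)

      *-inverse : g *ˢ inverse ≈ˢ 1ˢ
      *-inverse = begin
        g *ˢ G                     ≈⟨ S.*-congʳ {G} 1-f≈g ⟨
        (1ˢ -ˢ f) *ˢ G             ≈⟨ S.distribʳ G 1ˢ (-ˢ f) ⟩
        1ˢ *ˢ G +ˢ (-ˢ f) *ˢ G     ≈⟨ S.+-cong (S.*-identityˡ G) (S.sym (-‿distribˡ-* f G)) ⟩
        G -ˢ f *ˢ G                ≈⟨ S.+-congʳ { -ˢ (f *ˢ G)} fixed-point ⟩
        (1ˢ +ˢ f *ˢ G) -ˢ f *ˢ G   ≈⟨ S.+-assoc 1ˢ (f *ˢ G) (-ˢ (f *ˢ G)) ⟩
        1ˢ +ˢ (f *ˢ G -ˢ f *ˢ G)   ≈⟨ S.+-congˡ {1ˢ} (S.-‿inverseʳ (f *ˢ G)) ⟩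
        1ˢ +ˢ 0ˢ                   ≈⟨ S.+-identityʳ 1ˢ ⟩
        1ˢ                         ∎
        where
        G = inverse
        open RingProperties S.ring using (-‿distribˡ-*)
        open SetoidReasoning S.setoid

      unit : IsUnit g
      unit = inverse , (λ n → trans (*ˢ-comm inverse g n) (*-inverse n)) , *-inverse

------------------------------------------------------------------------
-- Univariate polynomials over a commutative ring: the power series with
-- finitely many nonzero coefficients

module Polynomials {c ℓ} (R : CommutativeRing c ℓ) where

  open CommutativeRing R
  open PowerSeries R using (Series; _≈ˢ_; 0ˢ; 1ˢ; _+ˢ_; _*ˢ_; -ˢ_; *ˢ-vanishes)
  private
    module S = CommutativeRing (PowerSeries.powerSeriesRing R)

  record Polynomial : Set (c ⊔ ℓ) where
    -- Keeps conversion checking in iterated polynomial rings tractable.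
    no-eta-equality
    field
      coeff    : Series
      bound    : ℕ
      vanishes : ∀ n → bound ≤ n → coeff n ≈ 0#

  open Polynomial public

  infix 4 _≈ᵖ_

  -- The bound is not part of the identity of a polynomial.
  record _≈ᵖ_ (p q : Polynomial) : Set ℓ where
    constructor mk≈
    field
      coeff-≈ : coeff p ≈ˢ coeff q

  open _≈ᵖ_ public

  infixl 6 _+ᵖ_
  infixl 7 _*ᵖ_
  infix  8 -ᵖ_

  _+ᵖ_ _*ᵖ_ : Polynomial → Polynomial → Polynomial
  coeff    (p +ᵖ q) = coeff p +ˢ coeff q
  bound    (p +ᵖ q) = bound p ℕ.+ bound q
  vanishes (p +ᵖ q) n b≤n = trans
    (+-cong (vanishes p n (ℕ.m+n≤o⇒m≤o (bound p) b≤n))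
            (vanishes q n (ℕ.m+n≤o⇒n≤o (bound p) b≤n)))
    (+-identityʳ 0#)
  coeff    (p *ᵖ q) = coeff p *ˢ coeff q
  bound    (p *ᵖ q) = bound p ℕ.+ bound q
  vanishes (p *ᵖ q) = *ˢ-vanishes (coeff p) (coeff q) (bound p) (bound q)
                                  (vanishes p) (vanishes q)

  -ᵖ_ : Polynomial → Polynomial
  coeff    (-ᵖ p) = -ˢ coeff p
  bound    (-ᵖ p) = bound p
  vanishes (-ᵖ p) n b≤n = trans (-‿cong (vanishes p n b≤n)) -0#≈0#
    where open RingProperties ring using (-0#≈0#)

  C : Carrier → Polynomial
  coeff    (C a) zero    = a
  coeff    (C a) (suc _) = 0#
  bound    (C a)         = 1
  vanishes (C a) (suc _) _ = refl

  0ᵖ 1ᵖ X : Polynomial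
  coeff    0ᵖ     = 0ˢ
  bound    0ᵖ     = 0
  vanishes 0ᵖ _ _ = refl
  coeff    1ᵖ     = 1ˢ
  bound    1ᵖ     = 1
  vanishes 1ᵖ (suc _) _ = refl
  coeff    X 1 = 1#
  coeff    X _ = 0#
  bound    X   = 2
  vanishes X (suc zero)    (s≤s ())
  vanishes X (suc (suc _)) _ = refl

  polynomialRing : CommutativeRing (c ⊔ ℓ) ℓ
  polynomialRing = record
    { Carrier = Polynomial
    ; _≈_     = _≈ᵖ_
    ; _+_     = _+ᵖ_
    ; _*_     = _*ᵖ_
    ; -_      = -ᵖ_
    ; 0#      = 0ᵖ
    ; 1#      = 1ᵖ
    ; isCommutativeRing = record
      { isRing = record
        { +-isAbelianGroup = record
          { isGroup = record
            { isMonoid = record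
              { isSemigroup = record
                { isMagma = record
                  { isEquivalence = record
                    { refl  = mk≈ λ _ → refl
                    ; sym   = λ p → mk≈ λ n → sym (coeff-≈ p n)
                    ; trans = λ p q → mk≈ λ n → trans (coeff-≈ p n) (coeff-≈ q n)
                    }
                  ; ∙-cong = λ p q → mk≈ (S.+-cong (coeff-≈ p) (coeff-≈ q))
                  }
                ; assoc = λ p q r → mk≈ (S.+-assoc (coeff p) (coeff q) (coeff r))
                }
              ; identity = (λ p → mk≈ (S.+-identityˡ (coeff p)))
                         , (λ p → mk≈ (S.+-identityʳ (coeff p)))
              }
            ; inverse = (λ p → mk≈ (S.-‿inverseˡ (coeff p)))
                      , (λ p → mk≈ (S.-‿inverseʳ (coeff p)))
            ; ⁻¹-cong = λ p → mk≈ (S.-‿cong (coeff-≈ p))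
            }
          ; comm = λ p q → mk≈ (S.+-comm (coeff p) (coeff q))
          }
        ; *-cong     = λ p q → mk≈ (S.*-cong (coeff-≈ p) (coeff-≈ q))
        ; *-assoc    = λ p q r → mk≈ (S.*-assoc (coeff p) (coeff q) (coeff r))
        ; *-identity = (λ p → mk≈ (S.*-identityˡ (coeff p)))
                     , (λ p → mk≈ (S.*-identityʳ (coeff p)))
        ; distrib    = (λ p q r → mk≈ (S.distribˡ (coeff p) (coeff q) (coeff r)))
                     , (λ p q r → mk≈ (S.distribʳ (coeff p) (coeff q) (coeff r)))
        }
      ; *-comm = λ p q → mk≈ (S.*-comm (coeff p) (coeff q))
      }
    }

------------------------------------------------------------------------
-- Permutations in one-line notation; the letters 1, …, n are represented
-- by the elements 0, …, n-1 of Fin n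

words : ∀ k n → List (Vec (Fin n) k)
words zero    n = [] ∷ []
words (suc k) n = List.cartesianProductWith _∷_ (List.allFin n) (words k n)

unique? : ∀ {n k} → Decidable (Unique {A = Fin n} {n = k})
unique? = allPairs? λ i j → ¬? (i Fin.≟ j)

𝔖 : ∀ n → List (Vec (Fin n) n)
𝔖 n = List.filter unique? (words n n)

module _ {n : ℕ} where

  infix 4 _<∞_ _<∞?_

  _<∞_ : Fin n ⁺ → Fin n ⁺ → Set
  _<∞_ = AddSupremum Fin._<_

  _<∞?_ : ∀ a b → Dec (a <∞ b)
  _<∞?_ = <⁺-dec Fin._<_ Fin._<?_

  -- π₀ π₁ ⋯ πₙ πₙ₊₁ with π₀ = πₙ₊₁ = ∞
  extend : ∀ {k} → Vec (Fin n) k → Vec (Fin n ⁺) (2 ℕ.+ k)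
  extend π = ∞ ∷ (Vec.map [_] π ∷ʳ ∞)

  module _ {k : ℕ} (π : Vec (Fin n) k) where

    -- For i : Fin k, the letter πᵢ₊₁ with its left and right neighbours.
    left letter right : Fin k → Fin n ⁺
    left   i = Vec.lookup (extend π) (inject₁ (inject₁ i))
    letter i = Vec.lookup (extend π) (inject₁ (suc i))
    right  i = Vec.lookup (extend π) (suc (suc i))

    Peak Valley DoubleAscent DoubleDescent : Fin k → Set
    Peak          i = left i <∞ letter i × right i <∞ letter i
    Valley        i = letter i <∞ left i × letter i <∞ right i
    DoubleAscent  i = left i <∞ letter i × letter i <∞ right i
    DoubleDescent i = letter i <∞ left i × right i <∞ letter i

    peak? : Decidable Peak
    peak? i = left i <∞? letter i ×-dec right i <∞? letter i

    valley? : Decidable Valley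
    valley? i = letter i <∞? left i ×-dec letter i <∞? right i

    doubleAscent? : Decidable DoubleAscent
    doubleAscent? i = left i <∞? letter i ×-dec letter i <∞? right i

    doubleDescent? : Decidable DoubleDescent
    doubleDescent? i = letter i <∞? left i ×-dec right i <∞? letter i

    pk val dasc ddes : ℕ
    pk   = Vec.count peak?          (Vec.allFin k)
    val  = Vec.count valley?        (Vec.allFin k)
    dasc = Vec.count doubleAscent?  (Vec.allFin k)
    ddes = Vec.count doubleDescent? (Vec.allFin k)

------------------------------------------------------------------------
-- The two generating functions, with coefficients in a commutative ring A
-- that contains the rational constants via ι

1/_! : ℕ → ℚ
1/ n ! = (+ 1 ℚ./ n !) {{n !≢0}}

module GeneratingFunctions {c ℓ} (A : CommutativeRing c ℓ)
                           (ι : ℚ → CommutativeRing.Carrier A) where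

  open CommutativeRing A
  open Exponentiation semiring using (_^_)
  open PowerSeries A

  Σ𝔖 : ∀ n → (Vec (Fin n) n → Carrier) → Carrier
  Σ𝔖 n w = List.foldr _+_ 0# (List.map w (𝔖 n))

  P : (s t u v : Carrier) → Series
  P s t u v zero      = 0#
  P s t u v n@(suc _) =
    ι (1/ n !) * Σ𝔖 n λ π → s ^ pk π * t ^ val π * u ^ dasc π * v ^ ddes π

  -- U n s t and V s t are the polynomial Uₙ and the series V with the ring
  -- elements s, t substituted for their two arguments.
  U : ℕ → (s t : Carrier) → Carrier
  U 0             s t = 1#
  U 1             s t = (1# + 1#) * t
  U (suc (suc n)) s t = (1# + 1#) * t * U (suc n) s t - s * U n s t

  V : (s t : Carrier) → Series
  V s t 0                 = 0#
  V s t 1                 = 0#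
  V s t n@(suc (suc n-2)) = ι (1/ n !) * U n-2 s t

  1-aV-unit : ∀ a s t → IsUnit (1ˢ -ˢ a · V s t)
  1-aV-unit a s t = unit _ (begin
    1# - a * 0#  ≈⟨ +-congˡ (-‿cong (zeroʳ a)) ⟩
    1# - 0#      ≈⟨ +-congˡ -0#≈0# ⟩
    1# + 0#      ≈⟨ +-identityʳ 1# ⟩
    1#           ∎)
    where
    open SetoidReasoning setoid
    open RingProperties ring using (-0#≈0#)

------------------------------------------------------------------------
-- ℚ[s,t,u,v], as iterated univariate polynomials

ℚ-ring ℚ[s] ℚ[s,t] ℚ[s,t,u] : CommutativeRing 0ℓ 0ℓ
ℚ-ring   = ℚ.+-*-commutativeRing
ℚ[s]     = Polynomials.polynomialRing ℚ-ring
ℚ[s,t]   = Polynomials.polynomialRing ℚ[s]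
ℚ[s,t,u] = Polynomials.polynomialRing ℚ[s,t]

module Ps = Polynomials ℚ-ring
module Pt = Polynomials ℚ[s]
module Pu = Polynomials ℚ[s,t]
module Pv = Polynomials ℚ[s,t,u]

ℚ[s,t,u,v] : CommutativeRing 0ℓ 0ℓ
ℚ[s,t,u,v] = Pv.polynomialRing

constant : ℚ → CommutativeRing.Carrier ℚ[s,t,u,v]
constant q = Pv.C (Pu.C (Pt.C (Ps.C q)))

s t u v : CommutativeRing.Carrier ℚ[s,t,u,v]
s = Pv.C (Pu.C (Pt.C Ps.X))
t = Pv.C (Pu.C Pt.X)
u = Pv.C Pu.X
v = Pv.X

{-# OPTIONS --safe #-}

-- Both sides satisfy the Riccati equation Q′ = t + (u + v) Q + s Q² with
-- Q(0) = 0.  For the quotient Q = t V′ / (1 - st V) this follows from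
-- V″ = 1 + (u + v) V′ - st V.  For permutations, remove the largest letter m
-- from π = σ m τ: it is a peak, a double ascent, a double descent or a valley
-- according to which of σ and τ are empty, and towards σ and τ it acts as ∞.
-- To count the pairs (σ, τ), build permutations by inserting letters in
-- decreasing order.  Every letter after m enters σ or τ, which is the Leibniz
-- rule for the derivatives of a product of exponential generating functions.

module Submission where

open import Algebra.Bundles using (CommutativeRing)
import Algebra.Properties.CommutativeMonoid.Mult as CommutativeMultiplication
import Algebra.Properties.CommutativeMonoid.Sum as CommutativeSummation
import Algebra.Properties.Ring as RingProperties
import Algebra.Properties.Semiring.Exp as Exponentiation
import Algebra.Properties.Semiring.Mult as Multiplication
import Algebra.Properties.Semiring.Sum as Summation
import Algebra.Solver.Ring.NaturalCoefficients.Default as Solver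
open import Data.Bool.Base using (Bool; true; false; if_then_else_; _∧_)
open import Data.Fin.Base as Fin using (Fin; zero; suc; toℕ; inject₁)
import Data.Fin.Properties as Fin
open import Data.Integer.Base as ℤ using (+_)
import Data.Integer.Properties as ℤ
import Data.Integer.Tactic.RingSolver as ℤ-Solver
open import Data.List.Base as List using (List; []; _∷_; _++_; _∷ʳ_; length; concatMap; initLast; _∷ʳ′_)
import Data.List.Properties as List
open import Data.List.Membership.Propositional using (_∈_; _∉_; find)
open import Data.List.Membership.Propositional.Properties
  using (∈-∃++; ∈-map⁺; ∈-map⁻; ∈-concatMap⁺; ∈-concatMap⁻; ∈-allFin; ∈-cartesianProductWith⁺; ∈-filter⁺; ∈-filter⁻)
open import Data.List.Membership.Propositional.Properties.WithK using (unique∧set⇒bag)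
open import Data.List.Relation.Binary.BagAndSetEquality using (∼bag⇒↭)
open import Data.List.Relation.Binary.Disjoint.Propositional using (Disjoint)
open import Data.List.Relation.Binary.Permutation.Propositional
  using (_↭_; ↭-refl; ↭-sym; ↭-trans; ↭-prep; ↭-swap; ↭⇒↭ₛ; ↭⇒↭ₛ′)
import Data.List.Relation.Binary.Permutation.Propositional.Properties as ↭
import Data.List.Relation.Binary.Permutation.Setoid.Properties as ↭ₛ
open import Data.List.Relation.Binary.Sublist.Propositional as Sublist using (_⊆_)
import Data.List.Relation.Binary.Sublist.Propositional.Properties as Sublist
open import Data.List.Relation.Unary.All as All using (All; []; _∷_)
import Data.List.Relation.Unary.All.Properties as All
open import Data.List.Relation.Unary.AllPairs using (AllPairs; []; _∷_)
import Data.List.Relation.Unary.AllPairs.Properties as AllPairs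
open import Data.List.Relation.Unary.Any as Any using (here; there)
open import Data.List.Relation.Unary.Unique.Propositional using (Unique)
import Data.List.Relation.Unary.Unique.Propositional.Properties as Unique
open import Data.Nat.Base as ℕ using (ℕ; zero; suc; _∸_; _≤_; _!)
import Data.Nat.Properties as ℕ
open import Data.Nat.Properties using (_!≢0)
open import Data.Product.Base using (_×_; _,_; proj₁; proj₂; ∃; map₁; map₂)
open import Data.Rational.Base as ℚ using (ℚ; ½)
import Data.Rational.Properties as ℚ
import Data.Rational.Unnormalised.Base as ℚᵘ
import Data.Rational.Unnormalised.Properties as ℚᵘ
open import Data.Vec.Base as Vec using (Vec; []; _∷_)
import Data.Vec.Properties as Vec
import Data.Vec.Relation.Unary.All.Properties as Vec using (toList⁺; toList⁻)
open import Data.Vec.Relation.Unary.AllPairs using ([]; _∷_)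
import Data.Vec.Relation.Unary.Unique.Propositional as VecUnique
open import Function.Base using (_∘_; id)
open import Function.Bundles using (mk⇔)
open import Relation.Binary.Construct.Add.Supremum.Strict as Supremum using (<⁺-asym)
open import Relation.Binary.Core using (Rel)
open import Relation.Binary.Definitions using (DecidableEquality)
open import Relation.Binary.PropositionalEquality as ≡ using (_≡_; _≢_; refl; cong; cong₂)
import Relation.Binary.Reasoning.Setoid as SetoidReasoning
open import Relation.Nullary.Construct.Add.Supremum using (_⁺; [_]) renaming (⊤⁺ to ∞)
open import Relation.Nullary.Decidable using (¬?; does; dec-true; dec-false)
open import Relation.Nullary.Negation using (contradiction)
open import Relation.Unary using (Decidable; Pred)
open import Defs

-- No uniqueness theorem for differential equations is invoked. `∑-nonemptyWeight` takes any Q that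
-- solves the equation with Q(0) = 0 and shows, by induction on the number of letters, that n! times
-- its n-th coefficient is the weighted count. The letters that fall on either side of m form
-- arbitrary subsets. The induction therefore concerns all increasing lists over one fixed `Fin n`,
-- so that σ and τ never have to be standardised. The right-hand side is used in the factored form 1
-- (t + v Q) + Q (u + s Q). In each product the left factor belongs to σ and the right factor to τ;
-- 1 and Q are the exponential generating functions of "empty" and "nonempty". Binomial coefficients
-- never appear: dealing one more letter to σ or to τ replaces f or g by its derivative in a product
-- f g. The permutations of the statement are filtered from all words, whereas the induction needs
-- lists grown by insertion. The two enumerations agree only as multisets, which suffices for sums.

-- Derivatives of power series and the Riccati equation of a quotient.

module SeriesCalculus {c ℓ} (R : CommutativeRing c ℓ) where

  open CommutativeRing R renaming (refl to ≈-refl)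
  open PowerSeries R
  open Multiplication semiring renaming (_×_ to _⋆_)
  open CommutativeMultiplication +-commutativeMonoid using (×-distrib-+)
  open Summation semiring
  open Solver commutativeSemiring using (solve; _:+_; _:*_; _:=_)
  private
    module ≈-Reasoning = SetoidReasoning setoid
  module S = CommutativeRing powerSeriesRing

  ⋆-zeroʳ : ∀ n → n ⋆ 0# ≈ 0#
  ⋆-zeroʳ n = trans (×-congʳ n (sym (zeroˡ 0#)))
                    (trans (sym (×-comm-* n 0# 0#)) (zeroˡ (n ⋆ 0#)))

  ⋆-distrib-sum : ∀ n {k} (x : Fin k → Carrier) → n ⋆ sum x ≈ sum λ i → n ⋆ x i
  ⋆-distrib-sum n {zero}  x = ⋆-zeroʳ n
  ⋆-distrib-sum n {suc k} x = trans (×-distrib-+ _ _ n) (+-congˡ (⋆-distrib-sum n (λ i → x (suc i))))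

  ·-*-assoc : ∀ a f g → (a · f) *ˢ g ≈ˢ a · (f *ˢ g)
  ·-*-assoc a f g n = trans
    (sum-cong-≋ {suc n} λ i → *-assoc a (f (toℕ i)) (g (n ∸ toℕ i)))
    (sym (*-distribˡ-sum {suc n} a (λ i → f (toℕ i) * g (n ∸ toℕ i))))

  *-·-comm : ∀ a f g → f *ˢ (a · g) ≈ˢ a · (f *ˢ g)
  *-·-comm a f g = S.trans (S.*-comm f (a · g))
    (S.trans (·-*-assoc a g f) λ n → *-congˡ (S.*-comm g f n))

  private
    -- The operator x d/dx. It acts on each coefficient separately, so its product rule needs no
    -- shift of indices.
    euler : Series → Series
    euler f n = n ⋆ f n

  -- In the coefficient of index n, the factor n of the i-th term splits as i + (n - i).
  euler-* : ∀ f g → euler (f *ˢ g) ≈ˢ euler f *ˢ g +ˢ f *ˢ euler g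
  euler-* f g n = let open ≈-Reasoning in begin
    n ⋆ (f *ˢ g) n
      ≈⟨ ⋆-distrib-sum n {suc n} (λ i → f (toℕ i) * g (n ∸ toℕ i)) ⟩
    (sum {suc n} λ i → n ⋆ (f (toℕ i) * g (n ∸ toℕ i)))
      ≈⟨ sum-cong-≋ {suc n} (λ i → term (toℕ i) (ℕ.≤-pred (Fin.toℕ<n i))) ⟩
    (sum {suc n} λ i → euler f (toℕ i) * g (n ∸ toℕ i) + f (toℕ i) * euler g (n ∸ toℕ i))
      ≈⟨ ∑-distrib-+ {suc n} (λ i → euler f (toℕ i) * g (n ∸ toℕ i))
                             (λ i → f (toℕ i) * euler g (n ∸ toℕ i)) ⟩
    (euler f *ˢ g +ˢ f *ˢ euler g) n  ∎
    where
    term : ∀ i → i ℕ.≤ n →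
           n ⋆ (f i * g (n ∸ i)) ≈ euler f i * g (n ∸ i) + f i * euler g (n ∸ i)
    term i i≤n = let open ≈-Reasoning in begin
      n ⋆ (f i * g (n ∸ i))
        ≡⟨ ≡.cong (_⋆ (f i * g (n ∸ i))) (ℕ.m+[n∸m]≡n i≤n) ⟨
      (i ℕ.+ (n ∸ i)) ⋆ (f i * g (n ∸ i))
        ≈⟨ ×-homo-+ _ i (n ∸ i) ⟩
      i ⋆ (f i * g (n ∸ i)) + (n ∸ i) ⋆ (f i * g (n ∸ i))
        ≈⟨ +-cong (×-assoc-* i _ _) (×-comm-* (n ∸ i) _ _) ⟨
      euler f i * g (n ∸ i) + f i * euler g (n ∸ i)  ∎

  -- The rule for `euler` divided by x: the term of index 0 of `euler f` vanishes, so dropping it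
  -- turns `euler f` into `∂ f`.
  ∂-* : ∀ f g → ∂ (f *ˢ g) ≈ˢ ∂ f *ˢ g +ˢ f *ˢ ∂ g
  ∂-* f g n = let open ≈-Reasoning in begin
    ∂ (f *ˢ g) n                                       ≈⟨ euler-* f g (suc n) ⟩
    (euler f *ˢ g) (suc n) + (f *ˢ euler g) (suc n)    ≈⟨ +-congˡ (S.*-comm f (euler g) (suc n)) ⟩
    (euler f *ˢ g) (suc n) + (euler g *ˢ f) (suc n)    ≈⟨ +-cong (shifted f g) (shifted g f) ⟩
    (∂ f *ˢ g) n + (∂ g *ˢ f) n                        ≈⟨ +-congˡ (S.*-comm (∂ g) f n) ⟩
    (∂ f *ˢ g) n + (f *ˢ ∂ g) n                        ∎
    where
    shifted : ∀ f g → (euler f *ˢ g) (suc n) ≈ (∂ f *ˢ g) n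
    shifted f g = trans (+-congʳ (zeroˡ _)) (+-identityˡ _)

  ∂-cong : ∀ {f g} → f ≈ˢ g → ∂ f ≈ˢ ∂ g
  ∂-cong p n = ×-congʳ (suc n) (p (suc n))

  ∂-+ : ∀ f g → ∂ (f +ˢ g) ≈ˢ ∂ f +ˢ ∂ g
  ∂-+ f g n = ×-distrib-+ _ _ (suc n)

  ∂-· : ∀ a f → ∂ (a · f) ≈ˢ a · ∂ f
  ∂-· a f n = sym (×-comm-* (suc n) a (f (suc n)))

  ∂-1 : ∂ 1ˢ ≈ˢ 0ˢ
  ∂-1 n = ⋆-zeroʳ (suc n)

  -- The sequence whose exponential generating function is `f`; differentiating `f` shifts it.
  factorialScaled : Series → Series
  factorialScaled f n = (n !) ⋆ f n

  factorialScaled-cong : ∀ {f g} → f ≈ˢ g → factorialScaled f ≈ˢ factorialScaled g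
  factorialScaled-cong p n = ×-congʳ (n !) (p n)

  factorialScaled-+ : ∀ f g → factorialScaled (f +ˢ g) ≈ˢ factorialScaled f +ˢ factorialScaled g
  factorialScaled-+ f g n = ×-distrib-+ _ _ (n !)

  factorialScaled-· : ∀ a f → factorialScaled (a · f) ≈ˢ a · factorialScaled f
  factorialScaled-· a f n = sym (×-comm-* (n !) a (f n))

  factorialScaled-suc : ∀ f n → factorialScaled f (suc n) ≈ factorialScaled (∂ f) n
  factorialScaled-suc f n = let open ≈-Reasoning in begin
    (suc n ℕ.* (n !)) ⋆ f (suc n)   ≡⟨ ≡.cong (_⋆ f (suc n)) (ℕ.*-comm (suc n) (n !)) ⟩
    ((n !) ℕ.* suc n) ⋆ f (suc n)   ≈⟨ ×-assocˡ _ (n !) (suc n) ⟨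
    (n !) ⋆ (suc n ⋆ f (suc n))     ∎

  -- Applied with `D` = 1 - st V, the derivative of V as `V′`, and `b` = u + v. The hypotheses form
  -- a linear first-order system for these two series, and the ratio of the components of such a
  -- system satisfies a Riccati equation.
  module Riccati (D V′ : Series) (D-unit : IsUnit D) (s t b : Carrier)
    (∂D : ∂ D +ˢ (s * t) · V′ ≈ˢ 0ˢ)
    (∂V′ : ∂ V′ ≈ˢ D +ˢ b · V′) where

    private
      module ≈ˢ-Reasoning = SetoidReasoning S.setoid
      D⁻¹ = proj₁ D-unit

    Q : Series
    Q = (t · V′) / D ⟨ D-unit ⟩

    Q*D : Q *ˢ D ≈ˢ t · V′
    Q*D = S.trans (S.*-assoc (t · V′) D⁻¹ D)
      (S.trans (S.*-congˡ {t · V′} (proj₁ (proj₂ D-unit))) (S.*-identityʳ (t · V′)))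

    ·-congˢ : ∀ a {f g} → f ≈ˢ g → a · f ≈ˢ a · g
    ·-congˢ a p n = *-congˡ (p n)

    -- Differentiating Q D = t V′ gives Q′ D = t V″ - Q D′. Here t V″ is t D + b (Q D), and -Q D′ is
    -- st (Q V′) = s Q (Q D), so every term is a multiple of D.
    riccati*D : ∂ Q *ˢ D ≈ˢ (t · 1ˢ +ˢ b · Q +ˢ s · (Q *ˢ Q)) *ˢ D
    riccati*D = S.sym (begin
      (t · 1ˢ +ˢ b · Q +ˢ s · (Q *ˢ Q)) *ˢ D
        ≈⟨ S.distribʳ D (t · 1ˢ +ˢ b · Q) (s · (Q *ˢ Q)) ⟩
      (t · 1ˢ +ˢ b · Q) *ˢ D +ˢ (s · (Q *ˢ Q)) *ˢ D
        ≈⟨ S.+-cong (S.trans (S.distribʳ D (t · 1ˢ) (b · Q)) linear)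
                     quadratic ⟩
      t · ∂ V′ +ˢ Q *ˢ ((s * t) · V′)
        ≈⟨ S.+-congʳ {Q *ˢ ((s * t) · V′)} (S.trans (∂-cong Q*D) (∂-· t V′)) ⟨
      ∂ (Q *ˢ D) +ˢ Q *ˢ ((s * t) · V′)
        ≈⟨ S.+-congʳ {Q *ˢ ((s * t) · V′)} (∂-* Q D) ⟩
      ∂ Q *ˢ D +ˢ Q *ˢ ∂ D +ˢ Q *ˢ ((s * t) · V′)
        ≈⟨ S.+-assoc (∂ Q *ˢ D) (Q *ˢ ∂ D) (Q *ˢ ((s * t) · V′)) ⟩
      ∂ Q *ˢ D +ˢ (Q *ˢ ∂ D +ˢ Q *ˢ ((s * t) · V′))
        ≈⟨ S.+-congˡ {∂ Q *ˢ D} (S.sym (S.distribˡ Q (∂ D) ((s * t) · V′))) ⟩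
      ∂ Q *ˢ D +ˢ Q *ˢ (∂ D +ˢ (s * t) · V′)
        ≈⟨ S.+-congˡ {∂ Q *ˢ D} (S.trans (S.*-congˡ {Q} ∂D) (S.zeroʳ Q)) ⟩
      ∂ Q *ˢ D +ˢ 0ˢ
        ≈⟨ S.+-identityʳ (∂ Q *ˢ D) ⟩
      ∂ Q *ˢ D  ∎)
      where
      open ≈ˢ-Reasoning
      linear : (t · 1ˢ) *ˢ D +ˢ (b · Q) *ˢ D ≈ˢ t · ∂ V′
      linear = begin
        (t · 1ˢ) *ˢ D +ˢ (b · Q) *ˢ D   ≈⟨ S.+-cong (·-*-assoc t 1ˢ D) (·-*-assoc b Q D) ⟩
        t · (1ˢ *ˢ D) +ˢ b · (Q *ˢ D)   ≈⟨ S.+-cong (·-congˢ t (S.*-identityˡ D)) (·-congˢ b Q*D) ⟩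
        t · D +ˢ b · (t · V′)           ≈⟨ (λ n → solve 4 (λ t b d v → t :* d :+ b :* (t :* v) := t :* (d :+ b :* v)) ≈-refl t b (D n) (V′ n)) ⟩
        t · (D +ˢ b · V′)               ≈⟨ ·-congˢ t ∂V′ ⟨
        t · ∂ V′                        ∎
      quadratic : (s · (Q *ˢ Q)) *ˢ D ≈ˢ Q *ˢ ((s * t) · V′)
      quadratic = begin
        (s · (Q *ˢ Q)) *ˢ D       ≈⟨ ·-*-assoc s (Q *ˢ Q) D ⟩
        s · (Q *ˢ Q *ˢ D)         ≈⟨ ·-congˢ s (S.*-assoc Q Q D) ⟩
        s · (Q *ˢ (Q *ˢ D))       ≈⟨ ·-congˢ s (S.*-congˡ {Q} Q*D) ⟩
        s · (Q *ˢ (t · V′))       ≈⟨ *-·-comm s Q (t · V′) ⟨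
        Q *ˢ (s · (t · V′))       ≈⟨ S.*-congˡ {Q} (λ n → *-assoc s t (V′ n)) ⟨
        Q *ˢ ((s * t) · V′)       ∎

    riccati : ∂ Q ≈ˢ t · 1ˢ +ˢ b · Q +ˢ s · (Q *ˢ Q)
    riccati = begin
      ∂ Q                    ≈⟨ cancel (∂ Q) ⟨
      ∂ Q *ˢ D *ˢ D⁻¹        ≈⟨ S.*-congʳ {D⁻¹} riccati*D ⟩
      F *ˢ D *ˢ D⁻¹          ≈⟨ cancel F ⟩
      F                      ∎
      where
      open ≈ˢ-Reasoning
      F = t · 1ˢ +ˢ b · Q +ˢ s · (Q *ˢ Q)
      cancel : ∀ f → f *ˢ D *ˢ D⁻¹ ≈ˢ f
      cancel f = S.trans (S.*-assoc f D D⁻¹)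
        (S.trans (S.*-congˡ {f} (proj₂ (proj₂ D-unit))) (S.*-identityʳ f))

-- Arrangements of a list, built by insertion.

-- `g` recovers from an output the entry that produced it, so the blocks of different entries are
-- disjoint.
concatMap-unique : ∀ {a b} {A : Set a} {B : Set b} (f : A → List B) (g : B → A) {xs} →
  All (λ x → Unique (f x) × All (λ y → g y ≡ x) (f x)) xs →
  Unique xs → Unique (concatMap f xs)
concatMap-unique f g []                 []           = []
concatMap-unique f g {x ∷ xs} ((fx! , gfx) ∷ ps) (x∉xs ∷ xs!) =
  Unique.++⁺ fx! (concatMap-unique f g ps xs!) disjoint
  where
  disjoint : Disjoint (f x) (concatMap f xs)
  disjoint (y∈fx , y∈) with x′ , x′∈ , y∈fx′ ← find (∈-concatMap⁻ f y∈) =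
    All.lookup x∉xs x′∈ (≡.trans (≡.sym (All.lookup gfx y∈fx))
                                 (All.lookup (proj₂ (All.lookup ps x′∈)) y∈fx′))

module _ {a} {A : Set a} where

  insertions : A → List A → List (List A)
  insertions x []       = (x ∷ []) ∷ []
  insertions x (y ∷ ys) = (x ∷ y ∷ ys) ∷ List.map (y ∷_) (insertions x ys)

  -- The head is inserted after the whole tail has been arranged, so in an increasing list the
  -- largest entry goes in first.
  arrangements : List A → List (List A)
  arrangements []       = [] ∷ []
  arrangements (x ∷ xs) = concatMap (insertions x) (arrangements xs)

  -- Mirrors the insertion of `x` into `σ ++ m ∷ τ`, with the separator `m` left out.
  insertionsInPair : A → List A × List A → List (List A × List A)
  insertionsInPair x (σ , τ) =
    List.map (_, τ) (insertions x σ) ++ List.map (σ ,_) (insertions x τ)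

  -- The pairs (σ, τ) such that σ ++ τ arranges the given list.
  pairArrangements : List A → List (List A × List A)
  pairArrangements []       = ([] , []) ∷ []
  pairArrangements (x ∷ xs) = concatMap (insertionsInPair x) (pairArrangements xs)

  splits : List A → List (List A × List A)
  splits []       = ([] , []) ∷ []
  splits (x ∷ xs) = List.map (map₁ (x ∷_)) (splits xs) ++ List.map (map₂ (x ∷_)) (splits xs)

  insertions-↭ : ∀ x ys {zs} → zs ∈ insertions x ys → zs ↭ x ∷ ys
  insertions-↭ x []       (here refl) = ↭-refl
  insertions-↭ x (y ∷ ys) (here refl) = ↭-refl
  insertions-↭ x (y ∷ ys) (there zs∈) with _ , zs′∈ , refl ← ∈-map⁻ (y ∷_) zs∈ =
    ↭-trans (↭-prep y (insertions-↭ x ys zs′∈)) (↭-swap y x ↭-refl)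

  ∈-insertions : ∀ x ys zs → ys ++ x ∷ zs ∈ insertions x (ys ++ zs)
  ∈-insertions x []       []       = here refl
  ∈-insertions x []       (z ∷ zs) = here refl
  ∈-insertions x (y ∷ ys) zs       = there (∈-map⁺ (y ∷_) (∈-insertions x ys zs))

  insertions-unique : ∀ x ys → x ∉ ys → Unique (insertions x ys)
  insertions-unique x []       x∉ = [] ∷ []
  insertions-unique x (y ∷ ys) x∉ =
    All.map⁺ (All.universal (λ _ eq → x∉ (here (List.∷-injectiveˡ eq))) _) ∷
    Unique.map⁺ List.∷-injectiveʳ (insertions-unique x ys (x∉ ∘ there))

  arrangements-↭ : ∀ xs {ys} → ys ∈ arrangements xs → ys ↭ xs
  arrangements-↭ []       (here refl) = ↭-refl
  arrangements-↭ (x ∷ xs) ys∈ with find (∈-concatMap⁻ (insertions x) ys∈)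
  ... | zs , zs∈ , ys∈′ = ↭-trans (insertions-↭ x zs ys∈′) (↭-prep x (arrangements-↭ xs zs∈))

  ∈-arrangements : ∀ xs {ys} → ys ↭ xs → ys ∈ arrangements xs
  ∈-arrangements []       ys↭ with refl ← ↭.↭-empty-inv ys↭ = here refl
  ∈-arrangements (x ∷ xs) ys↭
    with σ , τ , refl ← ∈-∃++ (↭.∈-resp-↭ (↭-sym ys↭) (here refl)) =
    ∈-concatMap⁺ (insertions x) (Any.map (λ { refl → ∈-insertions x σ τ })
      (∈-arrangements xs (↭.drop-mid σ [] ys↭)))

  module _ (_≟_ : DecidableEquality A) where

    differs : ∀ x → Decidable (x ≢_)
    differs x y = ¬? (x ≟ y)

    remove : A → List A → List A
    remove x = List.filter (differs x)

    -- Supplies the left inverse that `concatMap-unique` asks for.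
    remove-insertions : ∀ x ys → x ∉ ys → All (λ zs → remove x zs ≡ ys) (insertions x ys)
    remove-insertions x ys x∉ = All.tabulate (go ys x∉)
      where
      remove-∉ : ∀ ys → x ∉ ys → remove x ys ≡ ys
      remove-∉ ys x∉ = List.filter-all (differs x) (All.¬Any⇒All¬ ys x∉)
      remove-head : ∀ ys → x ∉ ys → remove x (x ∷ ys) ≡ ys
      remove-head ys x∉ = ≡.trans (List.filter-reject (differs x) λ x≢x → x≢x refl) (remove-∉ ys x∉)
      go : ∀ ys → x ∉ ys → ∀ {zs} → zs ∈ insertions x ys → remove x zs ≡ ys
      go []       x∉ (here refl) = remove-head [] x∉
      go (y ∷ ys) x∉ (here refl) = remove-head (y ∷ ys) x∉
      go (y ∷ ys) x∉ (there zs∈) with _ , zs′∈ , refl ← ∈-map⁻ (y ∷_) zs∈ =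
        ≡.trans (List.filter-accept (differs x) (x∉ ∘ here)) (cong (y ∷_) (go ys (x∉ ∘ there) zs′∈))

    arrangements-unique : ∀ {xs} → Unique xs → Unique (arrangements xs)
    arrangements-unique []              = [] ∷ []
    arrangements-unique {x ∷ xs} (x∉xs ∷ xs!) =
      concatMap-unique (insertions x) (remove x) (All.tabulate λ {ys} ys∈ →
          let x∉ys = λ x∈ys → All.lookup x∉xs (↭.∈-resp-↭ (arrangements-↭ xs ys∈) x∈ys) refl
          in insertions-unique x ys x∉ys , remove-insertions x ys x∉ys)
        (arrangements-unique xs!)

  module _ {p} {P : Pred A p} where

    All-insertions : ∀ {x ys} → P x → All P ys → All (All P) (insertions x ys)
    All-insertions px pys = All.tabulate λ zs∈ →
      ↭.All-resp-↭ (↭-sym (insertions-↭ _ _ zs∈)) (px ∷ pys)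

    All-pairArrangements : ∀ {xs} → All P xs →
      All (λ (σ , τ) → All P σ × All P τ) (pairArrangements xs)
    All-pairArrangements []         = ([] , []) ∷ []
    All-pairArrangements (px ∷ pxs) = All.concat⁺ (All.map⁺ (All.map
      (λ (pσ , pτ) → All.++⁺ (All.map⁺ (All.map (_, pτ) (All-insertions px pσ)))
                              (All.map⁺ (All.map (pσ ,_) (All-insertions px pτ))))
      (All-pairArrangements pxs)))

  -- Being sublists, both parts of an increasing list are increasing and no longer than the list, as
  -- the strong induction in `∑-nonemptyWeight` requires.
  splits-⊆ : ∀ xs → All (λ (ys , zs) → ys ⊆ xs × zs ⊆ xs) (splits xs)
  splits-⊆ []       = (Sublist.[] , Sublist.[]) ∷ []
  splits-⊆ (x ∷ xs) = All.++⁺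
    (All.map⁺ (All.map (λ (ys⊆ , zs⊆) → refl Sublist.∷ ys⊆ , x Sublist.∷ʳ zs⊆) (splits-⊆ xs)))
    (All.map⁺ (All.map (λ (ys⊆ , zs⊆) → x Sublist.∷ʳ ys⊆ , refl Sublist.∷ zs⊆) (splits-⊆ xs)))

-- Sums over arrangements, pairs of arrangements and splits.

module ListSums {c ℓ} (R : CommutativeRing c ℓ) where

  open CommutativeRing R renaming (refl to ≈-refl)
  open Multiplication semiring using (×-homo-1)
  open PowerSeries R using (Series; _*ˢ_; ∂; _+ˢ_)
  open SeriesCalculus R
  open Solver commutativeSemiring using (solve; _:+_; _:*_; _:=_)
  open SetoidReasoning setoid

  ∑ : ∀ {x} {X : Set x} → List X → (X → Carrier) → Carrier
  ∑ xs f = List.foldr _+_ 0# (List.map f xs)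

  module _ {x} {X : Set x} where

    ∑-congᴬ : ∀ {xs : List X} {f g} → All (λ x → f x ≈ g x) xs → ∑ xs f ≈ ∑ xs g
    ∑-congᴬ []       = ≈-refl
    ∑-congᴬ (p ∷ ps) = +-cong p (∑-congᴬ ps)

    ∑-cong : ∀ (xs : List X) {f g} → (∀ x → f x ≈ g x) → ∑ xs f ≈ ∑ xs g
    ∑-cong xs p = ∑-congᴬ (All.universal p xs)

    ∑-zero : ∀ (xs : List X) → ∑ xs (λ _ → 0#) ≈ 0#
    ∑-zero []       = ≈-refl
    ∑-zero (_ ∷ xs) = trans (+-identityˡ _) (∑-zero xs)

    ∑-++ : ∀ (xs ys : List X) f → ∑ (xs ++ ys) f ≈ ∑ xs f + ∑ ys f
    ∑-++ []       ys f = sym (+-identityˡ _)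
    ∑-++ (x ∷ xs) ys f = trans (+-congˡ (∑-++ xs ys f)) (sym (+-assoc _ _ _))

    ∑-+ : ∀ (xs : List X) f g → ∑ xs (λ x → f x + g x) ≈ ∑ xs f + ∑ xs g
    ∑-+ []       f g = sym (+-identityˡ _)
    ∑-+ (x ∷ xs) f g = trans (+-congˡ (∑-+ xs f g))
      (solve 4 (λ a b c d → a :+ b :+ (c :+ d) := a :+ c :+ (b :+ d)) ≈-refl _ _ _ _)

    ∑-*ˡ : ∀ a (xs : List X) f → ∑ xs (λ x → a * f x) ≈ a * ∑ xs f
    ∑-*ˡ a []       f = sym (zeroʳ a)
    ∑-*ˡ a (x ∷ xs) f = trans (+-congˡ (∑-*ˡ a xs f)) (sym (distribˡ _ _ _))

    ∑-*ʳ : ∀ a (xs : List X) f → ∑ xs (λ x → f x * a) ≈ ∑ xs f * a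
    ∑-*ʳ a []       f = sym (zeroˡ a)
    ∑-*ʳ a (x ∷ xs) f = trans (+-congˡ (∑-*ʳ a xs f)) (sym (distribʳ _ _ _))

    ∑-↭ : ∀ {xs ys : List X} f → xs ↭ ys → ∑ xs f ≈ ∑ ys f
    ∑-↭ f xs↭ys = ↭ₛ.foldr-commMonoid setoid +-isCommutativeMonoid
      (↭⇒↭ₛ′ isEquivalence (↭.map⁺ f xs↭ys))

  ∑-map : ∀ {x y} {X : Set x} {Y : Set y} (g : X → Y) xs f →
          ∑ (List.map g xs) f ≈ ∑ xs (f ∘ g)
  ∑-map g []       f = ≈-refl
  ∑-map g (x ∷ xs) f = +-congˡ (∑-map g xs f)

  ∑-concatMap : ∀ {x y} {X : Set x} {Y : Set y} (g : X → List Y) xs f →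
                ∑ (concatMap g xs) f ≈ ∑ xs (λ x → ∑ (g x) f)
  ∑-concatMap g []       f = ≈-refl
  ∑-concatMap g (x ∷ xs) f = trans (∑-++ (g x) _ f) (+-congˡ (∑-concatMap g xs f))

  module _ {a} {A : Set a} where

    private
      W : Set _
      W = List A → Carrier

    ∑-insertionsInPair : ∀ x σ τ (H : List A × List A → Carrier) →
      ∑ (insertionsInPair x (σ , τ)) H ≈
      ∑ (insertions x σ) (λ σ′ → H (σ′ , τ)) + ∑ (insertions x τ) (λ τ′ → H (σ , τ′))
    ∑-insertionsInPair x σ τ H = trans (∑-++ (List.map (_, τ) (insertions x σ)) _ H)
      (+-cong (∑-map (_, τ) (insertions x σ) H) (∑-map (σ ,_) (insertions x τ) H))

    -- Each gap of `σ ++ m ∷ τ` is a gap of σ or of τ: the one just before `m` ends σ, the one just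
    -- after it begins τ.
    ∑-insertions-++ : ∀ x σ m τ (H : W) → ∑ (insertions x (σ ++ m ∷ τ)) H ≈
      ∑ (insertions x σ) (λ σ′ → H (σ′ ++ m ∷ τ)) + ∑ (insertions x τ) (λ τ′ → H (σ ++ m ∷ τ′))
    ∑-insertions-++ x []      m τ H =
      +-cong (sym (+-identityʳ _)) (∑-map (m ∷_) (insertions x τ) H)
    ∑-insertions-++ x (y ∷ σ) m τ H = begin
      h + ∑ (List.map (y ∷_) (insertions x (σ ++ m ∷ τ))) H
        ≈⟨ +-congˡ (trans (∑-map (y ∷_) (insertions x (σ ++ m ∷ τ)) H) (∑-insertions-++ x σ m τ (H ∘ (y ∷_)))) ⟩
      h + (∑ (insertions x σ) (λ σ′ → H (y ∷ σ′ ++ m ∷ τ)) + _)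
        ≈⟨ +-assoc _ _ _ ⟨
      h + ∑ (insertions x σ) (λ σ′ → H (y ∷ σ′ ++ m ∷ τ)) + _
        ≈⟨ +-congʳ (+-congˡ (∑-map (y ∷_) (insertions x σ) _)) ⟨
      h + ∑ (List.map (y ∷_) (insertions x σ)) (λ σ′ → H (σ′ ++ m ∷ τ)) + _  ∎
      where h = H (x ∷ y ∷ σ ++ m ∷ τ)

    -- The last entry `m` is inserted first, and each later insertion falls to its left or to its
    -- right.
    ∑-arrangements-∷ʳ : ∀ xs m (H : W) →
      ∑ (arrangements (xs ∷ʳ m)) H ≈ ∑ (pairArrangements xs) (λ (σ , τ) → H (σ ++ m ∷ τ))
    ∑-arrangements-∷ʳ []       m H = ≈-refl
    ∑-arrangements-∷ʳ (x ∷ xs) m H = begin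
      ∑ (arrangements (x ∷ xs ∷ʳ m)) H
        ≈⟨ ∑-concatMap (insertions x) (arrangements (xs ∷ʳ m)) H ⟩
      ∑ (arrangements (xs ∷ʳ m)) (λ π → ∑ (insertions x π) H)
        ≈⟨ ∑-arrangements-∷ʳ xs m _ ⟩
      ∑ (pairArrangements xs) (λ (σ , τ) → ∑ (insertions x (σ ++ m ∷ τ)) H)
        ≈⟨ ∑-cong (pairArrangements xs) (λ (σ , τ) → trans (∑-insertions-++ x σ m τ H)
             (sym (∑-insertionsInPair x σ τ λ (σ , τ) → H (σ ++ m ∷ τ)))) ⟩
      ∑ (pairArrangements xs) (λ στ → ∑ (insertionsInPair x στ) (λ (σ , τ) → H (σ ++ m ∷ τ)))
        ≈⟨ ∑-concatMap (insertionsInPair x) (pairArrangements xs) _ ⟨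
      ∑ (pairArrangements (x ∷ xs)) (λ (σ , τ) → H (σ ++ m ∷ τ))  ∎

    ∑-splits-∷ : ∀ x xs (H : List A × List A → Carrier) →
      ∑ (splits (x ∷ xs)) H ≈
      ∑ (splits xs) (λ (ys , zs) → H (x ∷ ys , zs)) + ∑ (splits xs) (λ (ys , zs) → H (ys , x ∷ zs))
    ∑-splits-∷ x xs H = trans (∑-++ (List.map (map₁ (x ∷_)) (splits xs)) _ H)
      (+-cong (∑-map (map₁ (x ∷_)) (splits xs) H) (∑-map (map₂ (x ∷_)) (splits xs) H))

    -- Inserting `x` can be absorbed into the summand: F becomes its sum over the insertions of `x`,
    -- or G does. Hence the induction is over all F and G.
    ∑-pairArrangements : ∀ xs (F G : W) →
      ∑ (pairArrangements xs) (λ (σ , τ) → F σ * G τ) ≈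
      ∑ (splits xs) (λ (ys , zs) → ∑ (arrangements ys) F * ∑ (arrangements zs) G)
    ∑-pairArrangements []       F G =
      +-congʳ (*-cong (sym (+-identityʳ _)) (sym (+-identityʳ _)))
    ∑-pairArrangements (x ∷ xs) F G = begin
      ∑ (pairArrangements (x ∷ xs)) (λ (σ , τ) → F σ * G τ)
        ≈⟨ ∑-concatMap (insertionsInPair x) (pairArrangements xs) _ ⟩
      ∑ (pairArrangements xs) (λ στ → ∑ (insertionsInPair x στ) (λ (σ , τ) → F σ * G τ))
        ≈⟨ ∑-cong (pairArrangements xs) (λ (σ , τ) → trans (∑-insertionsInPair x σ τ _)
             (+-cong (∑-*ʳ (G τ) (insertions x σ) F) (∑-*ˡ (F σ) (insertions x τ) G))) ⟩
      ∑ (pairArrangements xs) (λ (σ , τ) → F′ σ * G τ + F σ * G′ τ)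
        ≈⟨ ∑-+ (pairArrangements xs) _ _ ⟩
      ∑ (pairArrangements xs) (λ (σ , τ) → F′ σ * G τ) +
      ∑ (pairArrangements xs) (λ (σ , τ) → F σ * G′ τ)
        ≈⟨ +-cong (∑-pairArrangements xs F′ G) (∑-pairArrangements xs F G′) ⟩
      ∑ (splits xs) (λ (ys , zs) → ∑ (arrangements ys) F′ * ∑ (arrangements zs) G) +
      ∑ (splits xs) (λ (ys , zs) → ∑ (arrangements ys) F * ∑ (arrangements zs) G′)
        ≈⟨ +-cong
             (∑-cong (splits xs) (λ (ys , zs) → *-congʳ (∑-concatMap (insertions x) (arrangements ys) F)))
             (∑-cong (splits xs) (λ (ys , zs) → *-congˡ (∑-concatMap (insertions x) (arrangements zs) G))) ⟨
      ∑ (splits xs) (λ (ys , zs) → ∑ (arrangements (x ∷ ys)) F * ∑ (arrangements zs) G) +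
      ∑ (splits xs) (λ (ys , zs) → ∑ (arrangements ys) F * ∑ (arrangements (x ∷ zs)) G)
        ≈⟨ ∑-splits-∷ x xs _ ⟨
      ∑ (splits (x ∷ xs)) (λ (ys , zs) → ∑ (arrangements ys) F * ∑ (arrangements zs) G)  ∎
      where
      F′ G′ : W
      F′ σ = ∑ (insertions x σ) F
      G′ τ = ∑ (insertions x τ) G

    -- Binomially many splits have a given length of ys, so the left-hand side is
    -- the binomial convolution of n! fₙ and n! gₙ.
    ∑-splits-factorialScaled : ∀ (xs : List A) f g →
      ∑ (splits xs) (λ (ys , zs) → factorialScaled f (length ys) * factorialScaled g (length zs)) ≈
      factorialScaled (f *ˢ g) (length xs)
    ∑-splits-factorialScaled []       f g = trans (+-identityʳ _)
      (trans (*-cong (×-homo-1 _) (×-homo-1 _))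
             (sym (trans (×-homo-1 _) (+-identityʳ _))))
    ∑-splits-factorialScaled (x ∷ xs) f g = begin
      ∑ (splits (x ∷ xs)) (λ (ys , zs) → f! (length ys) * g! (length zs))
        ≈⟨ ∑-splits-∷ x xs _ ⟩
      ∑ (splits xs) (λ (ys , zs) → f! (suc (length ys)) * g! (length zs)) +
      ∑ (splits xs) (λ (ys , zs) → f! (length ys) * g! (suc (length zs)))
        ≈⟨ +-cong
             (∑-cong (splits xs) (λ (ys , zs) → *-congʳ (factorialScaled-suc f (length ys))))
             (∑-cong (splits xs) (λ (ys , zs) → *-congˡ (factorialScaled-suc g (length zs)))) ⟩
      ∑ (splits xs) (λ (ys , zs) → factorialScaled (∂ f) (length ys) * g! (length zs)) +
      ∑ (splits xs) (λ (ys , zs) → f! (length ys) * factorialScaled (∂ g) (length zs))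
        -- The induction hypothesis is needed for the derivatives, which is why `f` and `g` are
        -- arbitrary series.
        ≈⟨ +-cong (∑-splits-factorialScaled xs (∂ f) g) (∑-splits-factorialScaled xs f (∂ g)) ⟩
      factorialScaled (∂ f *ˢ g) n + factorialScaled (f *ˢ ∂ g) n
        ≈⟨ factorialScaled-+ (∂ f *ˢ g) (f *ˢ ∂ g) n ⟨
      factorialScaled (∂ f *ˢ g +ˢ f *ˢ ∂ g) n
        ≈⟨ factorialScaled-cong (∂-* f g) n ⟨
      factorialScaled (∂ (f *ˢ g)) n
        ≈⟨ factorialScaled-suc (f *ˢ g) n ⟨
      factorialScaled (f *ˢ g) (suc n)  ∎
      where
      n  = length xs
      f! = factorialScaled f
      g! = factorialScaled g

-- Monomials of permutations as products of letter weights.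

module Weights {c ℓ} (R : CommutativeRing c ℓ) (s t u v : CommutativeRing.Carrier R) where

  open CommutativeRing R hiding (zero) renaming (refl to ≈-refl)
  open Exponentiation semiring using (_^_)
  open CommutativeSummation *-commutativeMonoid
    using () renaming (sum to ∏; ∑-distrib-+ to ∏-distrib-*)
  open Solver commutativeSemiring using (solve; _:+_; _:*_; _:=_; con)
  open SetoidReasoning setoid

  factor : Carrier → Bool → Carrier
  factor a b = if b then a else 1#

  -- Stated for a tabulated vector, since the tail of `allFin` is tabulated by `suc` and is not
  -- itself an `allFin`.
  ^-count : ∀ a {p k m} {P : Fin m → Set p} (P? : Decidable P) (f : Fin k → Fin m) →
            a ^ Vec.count P? (Vec.tabulate f) ≈ ∏ λ i → factor a (does (P? (f i)))
  ^-count a {k = zero}  P? f = ≈-refl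
  ^-count a {k = suc k} P? f with does (P? (f zero))
  ... | true  = *-congˡ (^-count a P? (f ∘ suc))
  ... | false = trans (^-count a P? (f ∘ suc)) (sym (*-identityˡ _))

  -- The arguments say whether the left and right neighbours are smaller
  -- than the letter, then whether they are larger.
  classWeight : (l< r< l> r> : Bool) → Carrier
  classWeight l< r< l> r> =
    factor s (l< ∧ r<) * factor t (l> ∧ r>) * factor u (l< ∧ r>) * factor v (l> ∧ r<)

  module _ {n : ℕ} where

    letterWeight : (l x r : Fin n ⁺) → Carrier
    letterWeight l x r =
      classWeight (does (l <∞? x)) (does (r <∞? x)) (does (x <∞? l)) (does (x <∞? r))

    firstOr : Fin n ⁺ → List (Fin n) → Fin n ⁺
    firstOr r []      = r
    firstOr r (x ∷ w) = [ x ]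

    lastOr : Fin n ⁺ → List (Fin n) → Fin n ⁺
    lastOr l []      = l
    lastOr l (x ∷ w) = lastOr [ x ] w

    -- The two outer neighbours are parameters, so that a word can be cut at a letter, which then
    -- bounds both pieces.
    wordWeight : Fin n ⁺ → List (Fin n) → Fin n ⁺ → Carrier
    wordWeight l []      r = 1#
    wordWeight l (x ∷ w) r = letterWeight l [ x ] (firstOr r w) * wordWeight [ x ] w r

    private
      -- `extend` with any left end: in the recursion the previous letter takes the place of ∞.
      extendBy : ∀ {k} → Fin n ⁺ → Vec (Fin n) k → Vec (Fin n ⁺) (suc (suc k))
      extendBy l π = l ∷ (Vec.map [_] π Vec.∷ʳ ∞)

      ∏-letterWeight : ∀ {k} l (π : Vec (Fin n) k) →
        (∏ λ i → letterWeight (Vec.lookup (extendBy l π) (inject₁ (inject₁ i)))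
                              (Vec.lookup (extendBy l π) (inject₁ (suc i)))
                              (Vec.lookup (extendBy l π) (suc (suc i)))) ≈
        wordWeight l (Vec.toList π) ∞
      ∏-letterWeight l []          = ≈-refl
      ∏-letterWeight l (x ∷ [])    = ≈-refl
      ∏-letterWeight l (x ∷ y ∷ π) = *-congˡ (∏-letterWeight [ x ] (y ∷ π))

    monomial≈wordWeight : ∀ {k} (π : Vec (Fin n) k) →
      s ^ pk π * t ^ val π * u ^ dasc π * v ^ ddes π ≈ wordWeight ∞ (Vec.toList π) ∞
    monomial≈wordWeight {k} π = begin
      s ^ pk π * t ^ val π * u ^ dasc π * v ^ ddes π
        ≈⟨ *-cong (*-cong (*-cong (^-count s (peak? π) id) (^-count t (valley? π) id))
             (^-count u (doubleAscent? π) id)) (^-count v (doubleDescent? π) id) ⟩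
      ∏ S * ∏ T * ∏ U * ∏ V
        ≈⟨ *-congʳ (*-congʳ (∏-distrib-* S T)) ⟨
      ∏ (λ i → S i * T i) * ∏ U * ∏ V
        ≈⟨ *-congʳ (∏-distrib-* (λ i → S i * T i) U) ⟨
      ∏ (λ i → S i * T i * U i) * ∏ V
        ≈⟨ ∏-distrib-* (λ i → S i * T i * U i) V ⟨
      ∏ (λ i → S i * T i * U i * V i)
        -- The truth value of a conjunction of decisions computes to the conjunction of their truth
        -- values, so each factor already is a `letterWeight`.
        ≈⟨ ∏-letterWeight ∞ π ⟩
      wordWeight ∞ (Vec.toList π) ∞  ∎
      where
      S T U V : Fin k → Carrier
      S i = factor s (does (peak? π i))
      T i = factor t (does (valley? π i))
      U i = factor u (does (doubleAscent? π i))
      V i = factor v (does (doubleDescent? π i))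

    private
      does-< : ∀ {x y : Fin n ⁺} → x <∞ y → does (x <∞? y) ≡ true
      does-< {x} {y} = dec-true (x <∞? y)

      does-> : ∀ {x y : Fin n ⁺} → x <∞ y → does (y <∞? x) ≡ false
      does-> {x} {y} x<y = dec-false (y <∞? x) (<⁺-asym Fin._<_ Fin.<-asym x<y)

    letterWeight-peak : ∀ {l x r} → l <∞ x → r <∞ x → letterWeight l x r ≈ s
    letterWeight-peak l<x r<x
      rewrite does-< l<x | does-> l<x | does-< r<x | does-> r<x =
      solve 1 (λ s → s :* con 1 :* con 1 :* con 1 := s) ≈-refl s

    letterWeight-valley : ∀ {l x r} → x <∞ l → x <∞ r → letterWeight l x r ≈ t
    letterWeight-valley x<l x<r
      rewrite does-< x<l | does-> x<l | does-< x<r | does-> x<r =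
      solve 1 (λ t → con 1 :* t :* con 1 :* con 1 := t) ≈-refl t

    letterWeight-ascent : ∀ {l x r} → l <∞ x → x <∞ r → letterWeight l x r ≈ u
    letterWeight-ascent l<x x<r
      rewrite does-< l<x | does-> l<x | does-< x<r | does-> x<r =
      solve 1 (λ u → con 1 :* con 1 :* u :* con 1 := u) ≈-refl u

    letterWeight-descent : ∀ {l x r} → x <∞ l → r <∞ x → letterWeight l x r ≈ v
    letterWeight-descent x<l r<x
      rewrite does-< x<l | does-> x<l | does-< r<x | does-> r<x =
      solve 1 (λ v → con 1 :* con 1 :* con 1 :* v := v) ≈-refl v

    -- Any neighbour larger than all letters of a word acts as ∞.
    wordWeight-left : ∀ {l} w r → All (λ x → [ x ] <∞ l) w →
                      wordWeight l w r ≡ wordWeight ∞ w r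
    wordWeight-left []      r []        = refl
    wordWeight-left (x ∷ w) r (x<l ∷ _) rewrite does-< x<l | does-> x<l = refl

    wordWeight-right : ∀ l {r} w → All (λ x → [ x ] <∞ r) w →
                       wordWeight l w r ≡ wordWeight l w ∞
    wordWeight-right l []          []          = refl
    wordWeight-right l (x ∷ [])    (x<r ∷ [])  rewrite does-< x<r | does-> x<r = refl
    wordWeight-right l (x ∷ y ∷ w) (_ ∷ w<r)   =
      cong (letterWeight l [ x ] [ y ] *_) (wordWeight-right [ x ] (y ∷ w) w<r)

    firstOr-++ : ∀ r w x w′ → firstOr r (w ++ x ∷ w′) ≡ firstOr [ x ] w
    firstOr-++ r []      x w′ = refl
    firstOr-++ r (_ ∷ _) x w′ = refl

    lastOr-All : ∀ {p} {P : Fin n ⁺ → Set p} {l} w → P l → All (λ x → P [ x ]) w → P (lastOr l w)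
    lastOr-All []      pl []        = pl
    lastOr-All {P = P} (x ∷ w) pl (px ∷ pw) = lastOr-All {P = P} w px pw

    wordWeight-++ : ∀ l σ m τ r → wordWeight l (σ ++ m ∷ τ) r ≈
      wordWeight l σ [ m ] * (letterWeight (lastOr l σ) [ m ] (firstOr r τ) * wordWeight [ m ] τ r)
    wordWeight-++ l []      m τ r = sym (*-identityˡ _)
    wordWeight-++ l (x ∷ σ) m τ r = trans
      (*-cong (reflexive (cong (letterWeight l [ x ]) (firstOr-++ r σ m τ)))
              (wordWeight-++ [ x ] σ m τ r))
      (sym (*-assoc _ _ _))

    -- The empty word would have weight 1, but P has no constant term. Splitting it off lets the
    -- emptiness of σ and τ select the class of m.
    emptyIndicator nonemptyWeight : List (Fin n) → Carrier
    emptyIndicator []      = 1#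
    emptyIndicator (_ ∷ _) = 0#
    nonemptyWeight []        = 0#
    nonemptyWeight w@(_ ∷ _) = wordWeight ∞ w ∞

    monomial≈nonemptyWeight : ∀ {k} (π : Vec (Fin n) (suc k)) →
      s ^ pk π * t ^ val π * u ^ dasc π * v ^ ddes π ≈ nonemptyWeight (Vec.toList π)
    monomial≈nonemptyWeight π@(_ ∷ _) = monomial≈wordWeight π

    -- Each of the four cases for σ and τ leaves one term. The form is bilinear and grouped by the
    -- factor of σ, so that sums over pairs (σ, τ) split into sums of products.
    nonemptyWeight-++ : ∀ {m} σ τ → All (Fin._< m) σ → All (Fin._< m) τ →
      nonemptyWeight (σ ++ m ∷ τ) ≈
      emptyIndicator σ * (t * emptyIndicator τ + v * nonemptyWeight τ) +
      nonemptyWeight σ * (u * emptyIndicator τ + s * nonemptyWeight τ)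
    nonemptyWeight-++ {m} σ τ σ<m τ<m = begin
      nonemptyWeight (σ ++ m ∷ τ)
        ≈⟨ nonempty σ ⟩
      wordWeight ∞ (σ ++ m ∷ τ) ∞
        ≈⟨ wordWeight-++ ∞ σ m τ ∞ ⟩
      wordWeight ∞ σ [ m ] * (letterWeight (lastOr ∞ σ) [ m ] (firstOr ∞ τ) * wordWeight [ m ] τ ∞)
        ≡⟨ cong₂ (λ a b → a * (letterWeight (lastOr ∞ σ) [ m ] (firstOr ∞ τ) * b))
             (wordWeight-right ∞ σ (All.map Supremum.[_] σ<m))
             (wordWeight-left τ ∞ (All.map Supremum.[_] τ<m)) ⟩
      wordWeight ∞ σ ∞ * (letterWeight (lastOr ∞ σ) [ m ] (firstOr ∞ τ) * wordWeight ∞ τ ∞)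
        ≈⟨ cases σ τ σ<m τ<m ⟩
      emptyIndicator σ * (t * emptyIndicator τ + v * nonemptyWeight τ) +
      nonemptyWeight σ * (u * emptyIndicator τ + s * nonemptyWeight τ)  ∎
      where
      nonempty : ∀ σ → nonemptyWeight (σ ++ m ∷ τ) ≈ wordWeight ∞ (σ ++ m ∷ τ) ∞
      nonempty []      = ≈-refl
      nonempty (_ ∷ _) = ≈-refl
      m<∞ : [ m ] <∞ ∞
      m<∞ = Supremum.[ m ]<⊤⁺
      last<m : ∀ {x} σ → x Fin.< m → All (Fin._< m) σ → lastOr [ x ] σ <∞ [ m ]
      last<m {x} σ x<m σ<m = lastOr-All {P = _<∞ [ m ]} {l = [ x ]} σ Supremum.[ x<m ] (All.map Supremum.[_] σ<m)
      cases : ∀ σ τ → All (Fin._< m) σ → All (Fin._< m) τ →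
        wordWeight ∞ σ ∞ * (letterWeight (lastOr ∞ σ) [ m ] (firstOr ∞ τ) * wordWeight ∞ τ ∞) ≈
        emptyIndicator σ * (t * emptyIndicator τ + v * nonemptyWeight τ) +
        nonemptyWeight σ * (u * emptyIndicator τ + s * nonemptyWeight τ)
      cases []      []      _ _ = trans
        (*-congˡ (*-congʳ (letterWeight-valley m<∞ m<∞)))
        (solve 4 (λ s t u v → con 1 :* (t :* con 1) :=
          con 1 :* (t :* con 1 :+ v :* con 0) :+ con 0 :* (u :* con 1 :+ s :* con 0)) ≈-refl s t u v)
      cases []      (y ∷ τ) _ (y<m ∷ _) = trans
        (*-congˡ (*-congʳ (letterWeight-descent m<∞ Supremum.[ y<m ])))
        (solve 5 (λ s t u v w → con 1 :* (v :* w) :=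
          con 1 :* (t :* con 0 :+ v :* w) :+ con 0 :* (u :* con 0 :+ s :* w)) ≈-refl s t u v _)
      cases (x ∷ σ) []      (x<m ∷ σ<m) _ = trans
        (*-congˡ (*-congʳ (letterWeight-ascent (last<m σ x<m σ<m) m<∞)))
        (solve 5 (λ s t u v w → w :* (u :* con 1) :=
          con 0 :* (t :* con 1 :+ v :* con 0) :+ w :* (u :* con 1 :+ s :* con 0)) ≈-refl s t u v _)
      cases (x ∷ σ) (y ∷ τ) (x<m ∷ σ<m) (y<m ∷ _) = trans
        (*-congˡ (*-congʳ (letterWeight-peak (last<m σ x<m σ<m) Supremum.[ y<m ])))
        (solve 6 (λ s t u v w w′ → w :* (s :* w′) :=
          con 0 :* (t :* con 0 :+ v :* w′) :+ w :* (u :* con 0 :+ s :* w′)) ≈-refl s t u v _ _)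

-- Increasing lists, and permutations as arrangements of all letters.

AllPairs-resp-⊆ : ∀ {a r} {A : Set a} {R : Rel A r} {xs ys} →
                  xs ⊆ ys → AllPairs R ys → AllPairs R xs
AllPairs-resp-⊆ Sublist.[]            []         = []
AllPairs-resp-⊆ (y Sublist.∷ʳ xs⊆)    (_ ∷ rys)  = AllPairs-resp-⊆ xs⊆ rys
AllPairs-resp-⊆ (refl Sublist.∷ xs⊆)  (ry ∷ rys) = Sublist.All-resp-⊆ xs⊆ ry ∷ AllPairs-resp-⊆ xs⊆ rys

AllPairs-∷ʳ⁻ : ∀ {a r} {A : Set a} {R : Rel A r} xs {x} →
               AllPairs R (xs ∷ʳ x) → AllPairs R xs × All (λ y → R y x) xs
AllPairs-∷ʳ⁻ []       _          = [] , []
AllPairs-∷ʳ⁻ (y ∷ xs) (ry ∷ rxs) with ry′ , ryx ← All.∷ʳ⁻ ry | rxs′ , rx ← AllPairs-∷ʳ⁻ xs rxs =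
  ry′ ∷ rxs′ , ryx ∷ rx

-- Pigeonhole principle: the head of `xs` does not recur in `xs`, so deleting it from both lists
-- keeps the inclusion, and equal lengths exhaust both together.
unique-↭ : ∀ {a} {A : Set a} {xs ys : List A} → Unique xs →
           (∀ {x} → x ∈ xs → x ∈ ys) → length xs ≡ length ys → xs ↭ ys
unique-↭ {xs = []}     {[]} _            _   _  = ↭-refl
unique-↭ {xs = x ∷ xs} {ys} (x∉xs ∷ xs!) xs⊆ eq
  with σ , τ , refl ← ∈-∃++ (xs⊆ (here refl)) =
  ↭-trans (↭-prep x (unique-↭ xs! xs⊆στ
            (ℕ.suc-injective (≡.trans eq (↭.↭-length (↭.shift x σ τ))))))
          (↭-sym (↭.shift x σ τ))
  where
  xs⊆στ : ∀ {y} → y ∈ xs → y ∈ σ ++ τ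
  xs⊆στ y∈xs with ↭.∈-resp-↭ (↭.shift x σ τ) (xs⊆ (there y∈xs))
  ... | here refl = contradiction refl (All.lookup x∉xs y∈xs)
  ... | there y∈  = y∈

toList-unique⁺ : ∀ {a} {A : Set a} {k} {π : Vec A k} → VecUnique.Unique π → Unique (Vec.toList π)
toList-unique⁺ []         = []
toList-unique⁺ (x∉ ∷ xs!) = Vec.toList⁺ x∉ ∷ toList-unique⁺ xs!

toList-unique⁻ : ∀ {a} {A : Set a} {k} {π : Vec A k} → Unique (Vec.toList π) → VecUnique.Unique π
toList-unique⁻ {π = []}    []         = []
toList-unique⁻ {π = _ ∷ _} (x∉ ∷ xs!) = Vec.toList⁻ x∉ ∷ toList-unique⁻ xs!

words-unique : ∀ k n → Unique (words k n)
words-unique zero    n = [] ∷ []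
words-unique (suc k) n =
  Unique.cartesianProductWith⁺ _∷_ Vec.∷-injective (Unique.allFin⁺ n) (words-unique k n)

∈-words : ∀ {k n} (π : Vec (Fin n) k) → π ∈ words k n
∈-words []      = here refl
∈-words (x ∷ π) = ∈-cartesianProductWith⁺ _∷_ (∈-allFin x) (∈-words π)

toList-surjective : ∀ {a} {A : Set a} {k} (xs : List A) → length xs ≡ k →
                    ∃ λ (π : Vec A k) → Vec.toList π ≡ xs
toList-surjective xs refl = Vec.fromList xs , Vec.toList∘fromList xs

-- Both lists are free of repetitions and have the same members, because n distinct letters of
-- `Fin n` are all of them. Hence they are equal as multisets.
toList-𝔖 : ∀ n → List.map Vec.toList (𝔖 n) ↭ arrangements (List.allFin n)
toList-𝔖 n = ∼bag⇒↭ (unique∧set⇒bag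
  (Unique.map⁺ toList-injective (Unique.filter⁺ unique? (words-unique n n)))
  (arrangements-unique Fin._≟_ (Unique.allFin⁺ n))
  (mk⇔ to from))
  where
  toList-injective : {π ρ : Vec (Fin n) n} → Vec.toList π ≡ Vec.toList ρ → π ≡ ρ
  toList-injective {π} {ρ} eq =
    ≡.trans (≡.sym (Vec.cast-is-id refl π)) (Vec.toList-injective refl π ρ eq)

  length-allFin : length (List.allFin n) ≡ n
  length-allFin = List.length-tabulate id

  to : ∀ {w} → w ∈ List.map Vec.toList (𝔖 n) → w ∈ arrangements (List.allFin n)
  to w∈ with π , π∈ , refl ← ∈-map⁻ Vec.toList w∈ =
    ∈-arrangements (List.allFin n)
      (unique-↭ (toList-unique⁺ (proj₂ (∈-filter⁻ unique? {xs = words n n} π∈)))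
        (λ {x} _ → ∈-allFin x)
        (≡.trans (Vec.length-toList π) (≡.sym length-allFin)))

  from : ∀ {w} → w ∈ arrangements (List.allFin n) → w ∈ List.map Vec.toList (𝔖 n)
  from {w} w∈ with w↭ ← arrangements-↭ (List.allFin n) w∈
    with π , refl ← toList-surjective w (≡.trans (↭.↭-length w↭) length-allFin) =
    ∈-map⁺ Vec.toList (∈-filter⁺ unique? (∈-words π)
      (toList-unique⁻ (↭ₛ.Unique-resp-↭ (≡.setoid _) (↭⇒↭ₛ (↭-sym w↭)) (Unique.allFin⁺ n))))

-- The weighted count of arrangements from the differential equation.

module _ {c ℓ} (R : CommutativeRing c ℓ) (s t u v : CommutativeRing.Carrier R) where

  open CommutativeRing R hiding (zero) renaming (refl to ≈-refl)
  open PowerSeries R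
  open SeriesCalculus R
  open ListSums R
  open Weights R s t u v
  open Multiplication semiring using (×-homo-1)
  open SetoidReasoning setoid

  module _ (Q : Series) (Q₀ : Q 0 ≈ 0#)
    (∂Q : ∂ Q ≈ˢ 1ˢ *ˢ (t · 1ˢ +ˢ v · Q) +ˢ Q *ˢ (u · 1ˢ +ˢ s · Q)) {n : ℕ} where

    ∑-emptyIndicator : ∀ (xs : List (Fin n)) →
      ∑ (arrangements xs) emptyIndicator ≈ factorialScaled 1ˢ (length xs)
    ∑-emptyIndicator []       = ≈-refl
    ∑-emptyIndicator (x ∷ xs) = begin
      ∑ (arrangements (x ∷ xs)) emptyIndicator
        ≈⟨ ∑-concatMap (insertions x) (arrangements xs) emptyIndicator ⟩
      ∑ (arrangements xs) (λ π → ∑ (insertions x π) emptyIndicator)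
        ≈⟨ ∑-cong (arrangements xs) (λ π → trans (∑-congᴬ (nonempty x π)) (∑-zero (insertions x π))) ⟩
      ∑ (arrangements xs) (λ _ → 0#)
        ≈⟨ ∑-zero (arrangements xs) ⟩
      0#
        ≈⟨ ⋆-zeroʳ (suc (length xs) !) ⟨
      factorialScaled 1ˢ (suc (length xs))  ∎
      where
      nonempty : ∀ x π → All (λ w → emptyIndicator w ≈ 0#) (insertions x π)
      nonempty x []      = ≈-refl ∷ []
      nonempty x (y ∷ π) = ≈-refl ∷ All.map⁺ (All.universal (λ _ → ≈-refl) (insertions x π))

    -- The sum of `nonemptyWeight` enters as a hypothesis, to be supplied by the induction
    -- hypothesis for a sublist.
    ∑-linear : ∀ (xs : List (Fin n)) a b →
      ∑ (arrangements xs) nonemptyWeight ≈ factorialScaled Q (length xs) →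
      ∑ (arrangements xs) (λ w → a * emptyIndicator w + b * nonemptyWeight w) ≈
      factorialScaled (a · 1ˢ +ˢ b · Q) (length xs)
    ∑-linear xs a b p = begin
      ∑ (arrangements xs) (λ w → a * emptyIndicator w + b * nonemptyWeight w)
        ≈⟨ ∑-+ (arrangements xs) _ _ ⟩
      ∑ (arrangements xs) (λ w → a * emptyIndicator w) + ∑ (arrangements xs) (λ w → b * nonemptyWeight w)
        ≈⟨ +-cong (∑-*ˡ a (arrangements xs) _) (∑-*ˡ b (arrangements xs) _) ⟩
      a * ∑ (arrangements xs) emptyIndicator + b * ∑ (arrangements xs) nonemptyWeight
        ≈⟨ +-cong (*-congˡ (∑-emptyIndicator xs)) (*-congˡ p) ⟩
      a * factorialScaled 1ˢ k + b * factorialScaled Q k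
        ≈⟨ +-cong (factorialScaled-· a 1ˢ k) (factorialScaled-· b Q k) ⟨
      factorialScaled (a · 1ˢ) k + factorialScaled (b · Q) k
        ≈⟨ factorialScaled-+ (a · 1ˢ) (b · Q) k ⟨
      factorialScaled (a · 1ˢ +ˢ b · Q) k  ∎
      where k = length xs

    -- Strong induction with `k` bounding the length, since the parts of a split are sublists of
    -- `xs` but not structurally smaller. The result depends only on the length of the increasing
    -- list.
    ∑-nonemptyWeight : ∀ k (xs : List (Fin n)) → length xs ≤ k → AllPairs Fin._<_ xs →
      ∑ (arrangements xs) nonemptyWeight ≈ factorialScaled Q (length xs)
    ∑-nonemptyWeight k xs xs≤k sorted with initLast xs
    ... | [] = trans (+-identityˡ 0#) (sym (trans (×-homo-1 (Q 0)) Q₀))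
    ∑-nonemptyWeight zero    .(xs ∷ʳ m) xs≤k sorted | xs ∷ʳ′ m =
      contradiction (≡.subst (_≤ 0) (List.length-++-comm xs (m ∷ [])) xs≤k) λ ()
    ∑-nonemptyWeight (suc k) .(xs ∷ʳ m) xs≤k sorted | xs ∷ʳ′ m = begin
      ∑ (arrangements (xs ∷ʳ m)) nonemptyWeight
        -- In an increasing list the last entry `m` is the largest letter.
        ≈⟨ ∑-arrangements-∷ʳ xs m nonemptyWeight ⟩
      ∑ (pairArrangements xs) (λ (σ , τ) → nonemptyWeight (σ ++ m ∷ τ))
        ≈⟨ ∑-congᴬ (All.map (λ {(σ , τ)} (σ<m , τ<m) → nonemptyWeight-++ σ τ σ<m τ<m)
             (All-pairArrangements xs<m)) ⟩
      ∑ (pairArrangements xs) (λ (σ , τ) → emptyIndicator σ * G₁ τ + nonemptyWeight σ * G₂ τ)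
        ≈⟨ ∑-+ (pairArrangements xs) _ _ ⟩
      ∑ (pairArrangements xs) (λ (σ , τ) → emptyIndicator σ * G₁ τ) +
      ∑ (pairArrangements xs) (λ (σ , τ) → nonemptyWeight σ * G₂ τ)
        ≈⟨ +-cong (∑-pairArrangements xs _ _) (∑-pairArrangements xs _ _) ⟩
      ∑ (splits xs) (λ (ys , zs) → ∑ (arrangements ys) emptyIndicator * ∑ (arrangements zs) G₁) +
      ∑ (splits xs) (λ (ys , zs) → ∑ (arrangements ys) nonemptyWeight * ∑ (arrangements zs) G₂)
        ≈⟨ +-cong
             (∑-congᴬ (All.map (λ {(ys , zs)} (ys⊆ , zs⊆) →
               *-cong (∑-emptyIndicator ys) (∑-linear zs t v (ih zs⊆))) (splits-⊆ xs)))
             (∑-congᴬ (All.map (λ {(ys , zs)} (ys⊆ , zs⊆) →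
               *-cong (ih ys⊆) (∑-linear zs u s (ih zs⊆))) (splits-⊆ xs))) ⟩
      ∑ (splits xs) (λ (ys , zs) → factorialScaled 1ˢ (length ys) * factorialScaled F₁ (length zs)) +
      ∑ (splits xs) (λ (ys , zs) → factorialScaled Q (length ys) * factorialScaled F₂ (length zs))
        ≈⟨ +-cong (∑-splits-factorialScaled xs 1ˢ F₁) (∑-splits-factorialScaled xs Q F₂) ⟩
      factorialScaled (1ˢ *ˢ F₁) l + factorialScaled (Q *ˢ F₂) l
        ≈⟨ factorialScaled-+ (1ˢ *ˢ F₁) (Q *ˢ F₂) l ⟨
      factorialScaled (1ˢ *ˢ F₁ +ˢ Q *ˢ F₂) l
        ≈⟨ factorialScaled-cong ∂Q l ⟨
      factorialScaled (∂ Q) l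
        ≈⟨ factorialScaled-suc Q l ⟨
      factorialScaled Q (suc l)
        ≡⟨ cong (factorialScaled Q) (List.length-++-comm xs (m ∷ [])) ⟨
      factorialScaled Q (length (xs ∷ʳ m))  ∎
      where
      l    = length xs
      F₁   = t · 1ˢ +ˢ v · Q
      F₂   = u · 1ˢ +ˢ s · Q
      G₁ G₂ : List (Fin n) → Carrier
      G₁ τ = t * emptyIndicator τ + v * nonemptyWeight τ
      G₂ τ = u * emptyIndicator τ + s * nonemptyWeight τ
      xs-sorted = proj₁ (AllPairs-∷ʳ⁻ xs sorted)
      xs<m      = proj₂ (AllPairs-∷ʳ⁻ xs sorted)
      l≤k : l ≤ k
      l≤k = ℕ.≤-pred (≡.subst (_≤ suc k) (List.length-++-comm xs (m ∷ [])) xs≤k)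
      ih : ∀ {ys} → ys ⊆ xs → ∑ (arrangements ys) nonemptyWeight ≈ factorialScaled Q (length ys)
      ih {ys} ys⊆ = ∑-nonemptyWeight k ys
        (ℕ.≤-trans (Sublist.length-mono-≤ ys⊆) l≤k) (AllPairs-resp-⊆ ys⊆ xs-sorted)

-- Multiples of inverse factorials.

open Multiplication (CommutativeRing.semiring ℚ-ring) using () renaming (_×_ to _⋆_)

-- Fractions with equal denominators are added among unnormalised rationals, where equality is
-- cross-multiplication and no reduction interferes.
⋆-1/ : ∀ k d .{{_ : ℕ.NonZero d}} → k ⋆ (+ 1 ℚ./ d) ≡ + k ℚ./ d
⋆-1/ zero    d         = ≡.sym (ℚ.0/n≡0 d)
⋆-1/ (suc k) d@(suc e) = ≡.trans (cong (ℚ._+_ (+ 1 ℚ./ d)) (⋆-1/ k d)) (ℚ.toℚᵘ-injective (begin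
  ℚ.toℚᵘ ((+ 1 ℚ./ d) ℚ.+ (+ k ℚ./ d))              ≈⟨ ℚ.toℚᵘ-homo-+ (+ 1 ℚ./ d) (+ k ℚ./ d) ⟩
  ℚ.toℚᵘ (+ 1 ℚ./ d) ℚᵘ.+ ℚ.toℚᵘ (+ k ℚ./ d)        ≈⟨ ℚᵘ.+-cong (ℚ.toℚᵘ-fromℚᵘ (ℚᵘ.mkℚᵘ (+ 1) e)) (ℚ.toℚᵘ-fromℚᵘ (ℚᵘ.mkℚᵘ (+ k) e)) ⟩
  ℚᵘ.mkℚᵘ (+ 1) e ℚᵘ.+ ℚᵘ.mkℚᵘ (+ k) e              ≈⟨ ℚᵘ.*≡* (sameDenominator (+ k) (+ d)) ⟩
  ℚᵘ.mkℚᵘ (+ suc k) e                               ≈⟨ ℚ.toℚᵘ-fromℚᵘ (ℚᵘ.mkℚᵘ (+ suc k) e) ⟨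
  ℚ.toℚᵘ (+ suc k ℚ./ d)                            ∎))
  where
  open SetoidReasoning ℚᵘ.≃-setoid
  sameDenominator : ∀ k d → (+ 1 ℤ.* d ℤ.+ k ℤ.* d) ℤ.* d ≡ (+ 1 ℤ.+ k) ℤ.* (d ℤ.* d)
  sameDenominator = ℤ-Solver.solve-∀

/-≡ : ∀ a b c d .{{_ : ℕ.NonZero b}} .{{_ : ℕ.NonZero d}} →
      a ℕ.* d ≡ c ℕ.* b → + a ℚ./ b ≡ + c ℚ./ d
/-≡ a (suc b) c (suc d) eq = ℚ.fromℚᵘ-cong {ℚᵘ.mkℚᵘ (+ a) b} {ℚᵘ.mkℚᵘ (+ c) d}
  (ℚᵘ.*≡* (≡.trans (≡.sym (ℤ.pos-* a (suc d))) (≡.trans (cong +_ eq) (ℤ.pos-* c (suc b)))))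

suc-⋆-1/! : ∀ n → suc n ⋆ 1/ suc n ! ≡ 1/ n !
suc-⋆-1/! n = ≡.trans (⋆-1/ (suc n) (suc n !) {{suc n !≢0}})
  (/-≡ (suc n) (suc n !) 1 (n !) {{suc n !≢0}} {{n !≢0}} (≡.sym (ℕ.*-identityˡ (suc n !))))

!-⋆-1/! : ∀ n → (n !) ⋆ 1/ n ! ≡ ℚ.1ℚ
!-⋆-1/! n = ≡.trans (⋆-1/ (n !) (n !) {{n !≢0}})
  (/-≡ (n !) (n !) 1 1 {{n !≢0}} (≡.trans (ℕ.*-identityʳ (n !)) (≡.sym (ℕ.*-identityˡ (n !)))))

-- The Chebyshev series and the identity over a general coefficient ring.

module GeneratingFunctionIdentity {c ℓ} (R : CommutativeRing c ℓ)
                                  (ι : ℚ → CommutativeRing.Carrier R) where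

  open CommutativeRing R hiding (zero) renaming (refl to ≈-refl)

  module _ (ι-+ : ∀ p q → ι (p ℚ.+ q) ≈ ι p + ι q)
           (ι-0 : ι ℚ.0ℚ ≈ 0#) (ι-1 : ι ℚ.1ℚ ≈ 1#) where

    open GeneratingFunctions R ι
    open PowerSeries R
    open SeriesCalculus R
    open ListSums R
    open Multiplication semiring using (×-homo-1; ×-assoc-*; ×-comm-*) renaming (_×_ to _⋆ᴿ_)
    open RingProperties ring using (-0#≈0#; -‿distribʳ-*)
    open Solver commutativeSemiring using (solve; _:+_; _:*_; _:=_; con)
    open SetoidReasoning setoid

    -- The factorial identities are phrased as natural multiples of 1/n!, so that additivity of `ι`
    -- carries them into the ring.
    ι-⋆ : ∀ n q → ι (n ⋆ q) ≈ n ⋆ᴿ ι q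
    ι-⋆ zero    q = ι-0
    ι-⋆ (suc n) q = trans (ι-+ q (n ⋆ q)) (+-congˡ (ι-⋆ n q))

    -- The exponential generating function of the sequence `f`.
    exponential : Series → Series
    exponential f n = ι (1/ n !) * f n

    ⋆-exponential : ∀ k {q r} x → k ⋆ q ≡ r → k ⋆ᴿ (ι q * x) ≈ ι r * x
    ⋆-exponential k {q} x refl = trans (sym (×-assoc-* k (ι q) x)) (*-congʳ (sym (ι-⋆ k q)))

    ∂-exponential : ∀ f → ∂ (exponential f) ≈ˢ exponential (f ∘ suc)
    ∂-exponential f n = ⋆-exponential (suc n) (f (suc n)) (suc-⋆-1/! n)

    exponential-factorialScaled : ∀ f → exponential (factorialScaled f) ≈ˢ f
    exponential-factorialScaled f n = begin
      ι (1/ n !) * ((n !) ⋆ᴿ f n)   ≈⟨ ×-comm-* (n !) _ _ ⟩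
      (n !) ⋆ᴿ (ι (1/ n !) * f n)   ≈⟨ ⋆-exponential (n !) (f n) (!-⋆-1/! n) ⟩
      ι ℚ.1ℚ * f n                  ≈⟨ *-congʳ ι-1 ⟩
      1# * f n                      ≈⟨ *-identityˡ _ ⟩
      f n                           ∎

    module _ (a h b : Carrier) (2h≈b : (1# + 1#) * h ≈ b) where

      private
        D : Series
        D = 1ˢ -ˢ a · V a h

      -- The factor x to the power n + 2 in V shifts the Chebyshev sequence by two places, so V″ has
      -- the coefficients Uₙ/n!.
      chebyshev : Series
      chebyshev zero          = 0#
      chebyshev (suc zero)    = 0#
      chebyshev (suc (suc n)) = U n a h

      V≈exponential : V a h ≈ˢ exponential chebyshev
      V≈exponential zero          = sym (zeroʳ _)
      V≈exponential (suc zero)    = sym (zeroʳ _)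
      V≈exponential (suc (suc n)) = ≈-refl

      ∂V≈exponential : ∂ (V a h) ≈ˢ exponential (chebyshev ∘ suc)
      ∂V≈exponential = S.trans (∂-cong V≈exponential) (∂-exponential chebyshev)

      -- Padded by two zeros, the recurrence would give 0 instead of 1 at n = 0 and is correct
      -- afterwards. The correction `1ˢ` becomes the constant 1 in V″ = 1 + b V′ - a V.
      U-recurrence : ∀ n → U n a h ≈ (1ˢ n + b * chebyshev (suc n)) + - (a * chebyshev n)
      U-recurrence zero = sym (begin
        (1# + b * 0#) + - (a * 0#)   ≈⟨ +-cong (+-congˡ (zeroʳ b)) (trans (-‿cong (zeroʳ a)) -0#≈0#) ⟩
        (1# + 0#) + 0#               ≈⟨ trans (+-identityʳ _) (+-identityʳ _) ⟩
        1#                           ∎)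
      U-recurrence (suc zero) = sym (begin
        (0# + b * 1#) + - (a * 0#)   ≈⟨ +-cong (+-identityˡ _) (trans (-‿cong (zeroʳ a)) -0#≈0#) ⟩
        b * 1# + 0#                  ≈⟨ trans (+-identityʳ _) (*-identityʳ b) ⟩
        b                            ≈⟨ 2h≈b ⟨
        (1# + 1#) * h                ∎)
      U-recurrence (suc (suc n)) =
        +-congʳ (trans (*-congʳ 2h≈b) (sym (+-identityˡ _)))

      ∂∂V : ∂ (∂ (V a h)) ≈ˢ D +ˢ b · ∂ (V a h)
      ∂∂V n = begin
        ∂ (∂ (V a h)) n
          ≈⟨ S.trans (∂-cong ∂V≈exponential) (∂-exponential (chebyshev ∘ suc)) n ⟩
        e * U n a h
          ≈⟨ *-congˡ (U-recurrence n) ⟩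
        e * ((1ˢ n + b * chebyshev (suc n)) + - (a * chebyshev n))
          ≈⟨ distribˡ _ _ _ ⟩
        e * (1ˢ n + b * chebyshev (suc n)) + e * - (a * chebyshev n)
          ≈⟨ +-cong (solve 4 (λ e o b x → e :* (o :+ b :* x) := e :* o :+ b :* (e :* x)) ≈-refl _ _ _ _)
                    (trans (sym (-‿distribʳ-* _ _)) (-‿cong
                      (solve 3 (λ e a x → e :* (a :* x) := a :* (e :* x)) ≈-refl _ _ _))) ⟩
        e * 1ˢ n + b * (e * chebyshev (suc n)) + - (a * (e * chebyshev n))
          ≈⟨ +-cong (+-cong (exponential-1 n) (*-congˡ (sym (∂V≈exponential n))))
                    (-‿cong (*-congˡ (sym (V≈exponential n)))) ⟩
        1ˢ n + b * ∂ (V a h) n + - (a * V a h n)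
          ≈⟨ solve 3 (λ x y z → x :+ y :+ z := x :+ z :+ y) ≈-refl _ _ _ ⟩
        (1ˢ n + - (a * V a h n)) + b * ∂ (V a h) n  ∎
        where
        e = ι (1/ n !)
        exponential-1 : exponential 1ˢ ≈ˢ 1ˢ
        exponential-1 zero    = trans (*-identityʳ _) ι-1
        exponential-1 (suc n) = zeroʳ _

      -- D + a V is the constant 1.
      ∂D : ∂ D +ˢ a · ∂ (V a h) ≈ˢ 0ˢ
      ∂D = S.trans (S.+-congˡ {∂ D} (S.sym (∂-· a (V a h))))
        (S.trans (S.sym (∂-+ D (a · V a h)))
          (S.trans (∂-cong {D +ˢ a · V a h} {1ˢ} (λ n → trans (+-assoc _ _ _)
            (trans (+-congˡ (-‿inverseˡ _)) (+-identityʳ _)))) ∂-1))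

    ½+½ : ∀ x → (1# + 1#) * (ι ½ * x) ≈ x
    ½+½ x = begin
      (1# + 1#) * (ι ½ * x)   ≈⟨ solve 2 (λ h x → (con 1 :+ con 1) :* (h :* x) := (h :+ h) :* x) ≈-refl (ι ½) x ⟩
      -- The rational sum ½ + ½ evaluates to 1, so `ι-1` applies to it directly.
      (ι ½ + ι ½) * x         ≈⟨ *-congʳ (trans (sym (ι-+ ½ ½)) ι-1) ⟩
      1# * x                  ≈⟨ *-identityˡ x ⟩
      x                       ∎

    module _ (s t u v : Carrier) where

      private
        st      = s * t
        [u+v]/2 = ι ½ * (u + v)
        V₀      = V st [u+v]/2
        D       = 1ˢ -ˢ st · V₀
        open Riccati D (∂ V₀) (1-aV-unit st st [u+v]/2) s t (u + v)
          (∂D st [u+v]/2 (u + v) (½+½ (u + v))) (∂∂V st [u+v]/2 (u + v) (½+½ (u + v)))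
          using (Q; riccati)

      -- V begins at x², so V′ has no constant term.
      Q₀ : Q 0 ≈ 0#
      Q₀ = trans (+-identityʳ _) (trans (*-congʳ (trans (*-congˡ (×-homo-1 0#)) (zeroʳ t))) (zeroˡ _))

      -- The term (u + v) Q is divided between the two products: v Q is the case of empty σ, u Q
      -- that of empty τ.
      ∂Q : ∂ Q ≈ˢ 1ˢ *ˢ (t · 1ˢ +ˢ v · Q) +ˢ Q *ˢ (u · 1ˢ +ˢ s · Q)
      ∂Q n = begin
        ∂ Q n
          ≈⟨ riccati n ⟩
        t * 1ˢ n + (u + v) * Q n + s * (Q *ˢ Q) n
          ≈⟨ solve 7 (λ t u v s o q r → t :* o :+ (u :+ v) :* q :+ s :* r := (t :* o :+ v :* q) :+ (u :* q :+ s :* r)) ≈-refl _ _ _ _ _ _ _ ⟩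
        (t * 1ˢ n + v * Q n) + (u * Q n + s * (Q *ˢ Q) n)
          ≈⟨ +-cong (S.*-identityˡ (t · 1ˢ +ˢ v · Q) n)
               (trans (S.distribˡ Q (u · 1ˢ) (s · Q) n)
                 (+-cong (trans (*-·-comm u Q 1ˢ n) (*-congˡ (S.*-identityʳ Q n))) (*-·-comm s Q Q n))) ⟨
        (1ˢ *ˢ (t · 1ˢ +ˢ v · Q) +ˢ Q *ˢ (u · 1ˢ +ˢ s · Q)) n  ∎

      open Weights R s t u v using (nonemptyWeight; monomial≈nonemptyWeight)

      P≈Q : P s t u v ≈ˢ Q
      P≈Q zero      = sym Q₀
      P≈Q n@(suc _) = begin
        P s t u v n
          ≈⟨ *-congˡ (∑-cong (𝔖 n) monomial≈nonemptyWeight) ⟩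
        e * ∑ (𝔖 n) (nonemptyWeight ∘ Vec.toList)
          ≈⟨ *-congˡ (∑-map Vec.toList (𝔖 n) nonemptyWeight) ⟨
        e * ∑ (List.map Vec.toList (𝔖 n)) nonemptyWeight
          ≈⟨ *-congˡ (∑-↭ nonemptyWeight (toList-𝔖 n)) ⟩
        e * ∑ (arrangements (List.allFin n)) nonemptyWeight
          ≈⟨ *-congˡ (∑-nonemptyWeight R s t u v Q Q₀ ∂Q (length (List.allFin n)) (List.allFin n) ℕ.≤-refl
               (AllPairs.tabulate⁺-< id)) ⟩
        e * factorialScaled Q (length (List.allFin n))
          ≡⟨ cong (λ k → e * factorialScaled Q k) (List.length-tabulate {n = n} id) ⟩
        e * factorialScaled Q n
          ≈⟨ exponential-factorialScaled Q n ⟩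
        Q n  ∎
        where e = ι (1/ n !)

-- Rational constants in the iterated polynomial ring.

module ConstantPolynomials {c ℓ} (R : CommutativeRing c ℓ) where

  open CommutativeRing R using (_≈_; _+_; 0#; 1#; +-identityʳ; sym) renaming (refl to ≈-refl)
  open Polynomials R

  C-cong : ∀ {a b} → a ≈ b → C a ≈ᵖ C b
  C-cong a≈b = mk≈ λ { zero → a≈b ; (suc _) → ≈-refl }

  C-+ : ∀ a b → C (a + b) ≈ᵖ C a +ᵖ C b
  C-+ a b = mk≈ λ { zero → ≈-refl ; (suc _) → sym (+-identityʳ 0#) }

  C-0 : C 0# ≈ᵖ 0ᵖ
  C-0 = mk≈ λ { zero → ≈-refl ; (suc _) → ≈-refl }

  C-1 : C 1# ≈ᵖ 1ᵖ
  C-1 = mk≈ λ { zero → ≈-refl ; (suc _) → ≈-refl }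

module Constant where

  private
    module S = ConstantPolynomials ℚ-ring
    module T = ConstantPolynomials ℚ[s]
    module U = ConstantPolynomials ℚ[s,t]
    module V = ConstantPolynomials ℚ[s,t,u]
    module Rᵗ = CommutativeRing ℚ[s,t]
    module Rᵘ = CommutativeRing ℚ[s,t,u]
  open CommutativeRing ℚ[s,t,u,v]

  -- `constant` nests four constant embeddings; the additivity of each is carried outwards through
  -- the next by `C-cong`.
  constant-+ : ∀ p q → constant (p ℚ.+ q) ≈ constant p + constant q
  constant-+ p q = trans (V.C-cong (Rᵘ.trans (U.C-cong (Rᵗ.trans (T.C-cong (S.C-+ p q))
    (T.C-+ _ _))) (U.C-+ _ _))) (V.C-+ _ _)

  constant-0 : constant ℚ.0ℚ ≈ 0#
  constant-0 = trans (V.C-cong (Rᵘ.trans (U.C-cong (Rᵗ.trans (T.C-cong S.C-0) T.C-0)) U.C-0)) V.C-0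

  constant-1 : constant ℚ.1ℚ ≈ 1#
  constant-1 = trans (V.C-cong (Rᵘ.trans (U.C-cong (Rᵗ.trans (T.C-cong S.C-1) T.C-1)) U.C-1)) V.C-1

theorem4 :
  let module A = CommutativeRing ℚ[s,t,u,v]
      open PowerSeries ℚ[s,t,u,v]
      open GeneratingFunctions ℚ[s,t,u,v] constant
      st      = s A.* t
      [u+v]/2 = constant ½ A.* (u A.+ v)
  in P s t u v ≈ˢ
     (t · ∂ (V st [u+v]/2)) / (1ˢ -ˢ st · V st [u+v]/2) ⟨ 1-aV-unit st st [u+v]/2 ⟩
theorem4 = GeneratingFunctionIdentity.P≈Q ℚ[s,t,u,v] constant Constant.constant-+ Constant.constant-0 Constant.constant-1 s t u v
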